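{- For all integers $n \geq k \geq 3$ we have $\mathrm{ar}^{\star}(n,C_k)=n+\binom{k-2}{2}-1$. Moreover, every star-colouring of $K_n$ that contains no rainbow copy of $C_k$ and uses exactly $n+\binom{k-2}{2}-1 = n-k+1+\binom{k-1}{2}$ colours has, up to renaming the colours, the following structure. The vertex set of $K_n$ is the union of disjoint sets $A,B$ of sizes $n-k+1$ and $k-1$ respectively, and there is an oriented graph $\overrightarrow{T}$ on $A\cup B$ obtained from a tournament on $A$ containing no directed cycle $\overrightarrow{C_k}$ of length $k$ by adding all possible directed edges from $A$ to $B$, such that: for each vertex $x \in A$ and each outneighbour $y \in N^+_{\overrightarrow{T}}(x)$, the edge $xy$ has colour $x$ (so distinct vertices of $A$ give distinct colours), and the pairs inside $B$ receive pairwise distinct colours, none of which is used elsewhere.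
   Context: A star-colouring of a graph $G$ is an edge-colouring of $G$ in which every colour class is a star (a copy of $K_{1,m}$ with $m\ge 1$, a single edge being allowed); equivalently, there is no monochromatic matching of size two and no monochromatic triangle. An $s$-star-colouring is a star-colouring using exactly $s$ colours. An edge-coloured graph is rainbow if all its edges have different colours. For a graph $H$, $\mathrm{ar}^{\star}(n,H)$ denotes the maximum $s\in\mathbb N$ such that there exists an $s$-star-colouring of $K_n$ without a rainbow copy of $H$. $C_k$ is the cycle with $k$ vertices. $\overrightarrow{C_k}$ is the oriented graph with vertices $v_1,\dots,v_k$ and arcs $v_i\to v_{i+1}$ (indices modulo $k$). A tournament is an orientation of a complete graph. -}

module Defs where

open import Data.Fin using (Fin; zero; suc; toℕ)
open import Data.Fin.Subset using (Subset; _∈_; _∪_; _∩_; ⊤; Empty; ∣_∣)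
open import Data.Nat using (ℕ; suc; _+_; _∸_; _≤_; s≤s)
open import Data.Product using (Σ-syntax; ∃-syntax; _×_; _,_)
open import Data.Sum using (_⊎_; inj₁; inj₂; swap)
open import Function using (_⇔_; Injective)
open import Level using (0ℓ)
open import Relation.Binary using (Rel; Symmetric; Asymmetric)
open import Relation.Binary.PropositionalEquality
  using (_≡_; _≢_; refl; trans; cong; ≢-sym)
open import Relation.Nullary using (¬_)

record Graph (n : ℕ) : Set₁ where
  field
    Adj    : Rel (Fin n) 0ℓ
    symm   : Symmetric Adj
    irrefl : ∀ {x} → ¬ Adj x x

open Graph public

record OrientedGraph (n : ℕ) : Set₁ where
  field
    Arc  : Rel (Fin n) 0ℓ
    asym : Asymmetric Arc

open OrientedGraph public

-- Copies are subgraphs, not necessarily induced.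
record Copy {h n} (H : Graph h) (G : Graph n) : Set where
  field
    map       : Fin h → Fin n
    injective : Injective _≡_ _≡_ map
    preserves : ∀ {i j} → Adj H i j → Adj G (map i) (map j)

record DirectedCopy {h n} (H : OrientedGraph h) (G : OrientedGraph n) : Set where
  field
    map       : Fin h → Fin n
    injective : Injective _≡_ _≡_ map
    preserves : ∀ {i j} → Arc H i j → Arc G (map i) (map j)

K : ∀ n → Graph n
K n = record { Adj = _≢_ ; symm = ≢-sym ; irrefl = λ x≢x → x≢x refl }

data StarAdj {m} : Rel (Fin (suc m)) 0ℓ where
  outward : ∀ {i} → StarAdj zero (suc i)
  inward  : ∀ {i} → StarAdj (suc i) zero

-- K_{1,m}, with centre zero.
Star : ∀ m → Graph (suc m)
Star m = record
  { Adj    = StarAdj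
  ; symm   = λ { outward → inward ; inward → outward }
  ; irrefl = λ ()
  }

-- j is the successor of i modulo k.
data _↝_ {k} (i j : Fin k) : Set where
  step : toℕ j ≡ suc (toℕ i) → i ↝ j
  wrap : suc (toℕ i) ≡ k → toℕ j ≡ 0 → i ↝ j

private
  no-2-cycle : ∀ {a b : ℕ} → b ≡ suc a → a ≢ suc b
  no-2-cycle refl ()

  no-short-wrap : ∀ {k a b : ℕ} → 3 ≤ k → b ≡ suc a → suc b ≡ k → a ≢ 0
  no-short-wrap (s≤s (s≤s ())) refl refl refl

  no-double-wrap : ∀ {k a : ℕ} → 3 ≤ k → suc a ≡ k → a ≢ 0
  no-double-wrap (s≤s ()) refl refl

↝-asym : ∀ {k} → 3 ≤ k → Asymmetric (_↝_ {k})
↝-asym 3≤k (step p)   (step q)   = no-2-cycle p q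
↝-asym 3≤k (step p)   (wrap q r) = no-short-wrap 3≤k p q r
↝-asym 3≤k (wrap q r) (step p)   = no-short-wrap 3≤k p q r
↝-asym 3≤k (wrap p _) (wrap _ r) = no-double-wrap 3≤k p r

DirectedCycle : ∀ k → 3 ≤ k → OrientedGraph k
DirectedCycle k 3≤k = record { Arc = _↝_ ; asym = ↝-asym 3≤k }

Cycle : ∀ k → 3 ≤ k → Graph k
Cycle k 3≤k = record
  { Adj    = λ i j → i ↝ j ⊎ j ↝ i
  ; symm   = swap
  ; irrefl = λ { (inj₁ p) → ↝-asym 3≤k p p ; (inj₂ p) → ↝-asym 3≤k p p }
  }

SameEdge : ∀ {n} → (u v x y : Fin n) → Set
SameEdge u v x y = (u ≡ x × v ≡ y) ⊎ (u ≡ y × v ≡ x)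

-- The colour of a pair depends neither on the proof that it is an edge
-- (irrelevance) nor on the order of its ends.
record Colouring {n} (G : Graph n) (C : Set) : Set where
  field
    colour     : ∀ x y → .(Adj G x y) → C
    colour-sym : ∀ x y .(p : Adj G x y) .(q : Adj G y x) → colour x y p ≡ colour y x q

open Colouring public

rename : ∀ {n} {G : Graph n} {C D : Set} → (C → D) → Colouring G C → Colouring G D
rename ρ c = record
  { colour     = λ x y p → ρ (colour c x y p)
  ; colour-sym = λ x y p q → cong ρ (colour-sym c x y p q)
  }

colourClass : ∀ {n} {G : Graph n} {C : Set} → Colouring G C → C → Graph n
colourClass {G = G} c i = record
  { Adj    = λ x y → Σ[ p ∈ Adj G x y ] colour c x y p ≡ i
  ; symm   = λ {x} {y} (p , e) → symm G p , trans (colour-sym c y x (symm G p) p) e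
  ; irrefl = λ (p , _) → irrefl G p
  }

-- The edges of G form a copy of K_{1,m}; isolated vertices of G are ignored.
record IsStar {n} (G : Graph n) : Set where
  field
    m       : ℕ
    1≤m     : 1 ≤ m
    copy    : Copy (Star m) G
  open Copy copy
  field
    covers  : ∀ {x y} → Adj G x y →
              ∃[ i ] ∃[ j ] (Adj (Star m) i j × map i ≡ x × map j ≡ y)

IsUsed : ∀ {n} {G : Graph n} {C : Set} → Colouring G C → C → Set
IsUsed c i = ∃[ x ] ∃[ y ] Adj (colourClass c i) x y

IsStarColouring : ∀ {n} {G : Graph n} {C : Set} → Colouring G C → Set
IsStarColouring c = ∀ i → IsUsed c i → IsStar (colourClass c i)

-- A star-colouring using exactly s colours.
_-StarColouring : ∀ {n} {G : Graph n} s → Colouring G (Fin s) → Set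
(s -StarColouring) c = IsStarColouring c × (∀ i → IsUsed c i)

record RainbowCopy {h n} (H : Graph h) {G : Graph n} {C : Set} (c : Colouring G C) : Set where
  field
    copy : Copy H G
  open Copy copy
  field
    rainbow : ∀ {i j i′ j′} (e : Adj H i j) (e′ : Adj H i′ j′) →
              colour c (map i) (map j) (preserves e) ≡
              colour c (map i′) (map j′) (preserves e′) →
              SameEdge i j i′ j′

Attains : ∀ {h} → ℕ → Graph h → ℕ → Set
Attains n H s = Σ[ c ∈ Colouring (K n) (Fin s) ] ((s -StarColouring) c × ¬ RainbowCopy H c)

-- ar⋆(n, H) = s
ar⋆⟨_,_⟩≡_ : ∀ {h} → ℕ → Graph h → ℕ → Set
ar⋆⟨ n , H ⟩≡ s = Attains n H s × (∀ t → Attains n H t → t ≤ s)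

record IsTournamentOn {n} (A : Subset n) (τ : OrientedGraph n) : Set where
  field
    within : ∀ {x y} → Arc τ x y → x ∈ A × y ∈ A
    total  : ∀ {x y} → x ∈ A → y ∈ A → x ≢ y → Arc τ x y ⊎ Arc τ y x

-- Vertices serve as colours, alongside infinitely many other colours.
Palette : ℕ → Set
Palette n = Fin n ⊎ ℕ

record Extremal {n} k (3≤k : 3 ≤ k) (c : Colouring (K n) (Palette n)) : Set₁ where
  field
    A B       : Subset n
    cover     : A ∪ B ≡ ⊤
    disjoint  : Empty (A ∩ B)
    ∣A∣       : ∣ A ∣ ≡ n ∸ k + 1
    ∣B∣       : ∣ B ∣ ≡ k ∸ 1
    τ         : OrientedGraph n
    τ-tour    : IsTournamentOn A τ
    τ-noCycle : ¬ DirectedCopy (DirectedCycle k 3≤k) τ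
    T         : OrientedGraph n
    T-arcs    : ∀ x y → Arc T x y ⇔ (Arc τ x y ⊎ (x ∈ A × y ∈ B))
    A-colours : ∀ {x y} → x ∈ A → Arc T x y → (x≢y : x ≢ y) → colour c x y x≢y ≡ inj₁ x
    -- An edge sharing its colour with a pair inside B is that very pair.
    B-colours : ∀ {u v x y} → u ∈ B → v ∈ B → (u≢v : u ≢ v) (x≢y : x ≢ y) →
                colour c u v u≢v ≡ colour c x y x≢y → SameEdge u v x y

module Submission where

-- Two edges of one colour share the centre of its star, so a cycle is rainbow as soon as consecutive
-- edges differ in colour. Let C be a rainbow C_{k-1} in a colouring without a rainbow C_k. Since a
-- further vertex x cannot be inserted anywhere into C, either x sends a single colour to all of C, or,
-- for one of the two orientations of C, each v in C gives its edge to x the colour of its arc to the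
-- next vertex. If all outside vertices are of the first kind they can be peeled off, leaving C; otherwise
-- all vertices but those of the second kind can be peeled off. A peeled vertex v brings one colour, that
-- of its edges to the remaining vertices, and an edge between peeled vertices has the colour of an end.
-- Iterating, with k - 1 for k when there is no rainbow C_{k-1} (and peeling single vertices if k = 3),
-- leaves a core of r ≤ k - 1 vertices, hence at most n - r + C(r,2) colours. This is maximal only for
-- r = k - 1, and then equality makes the colours of peeled vertices and core pairs distinct.

open import Defs
open import Data.Empty using (⊥; ⊥-elim; ⊥-elim-irr)
open import Data.Fin using (Fin; zero; suc; toℕ; punchOut; fromℕ; fromℕ<; inject₁; _↑ˡ_; _↑ʳ_; splitAt)
import Data.Fin.Properties as Finₚ
open import Data.Fin.Subset using (Subset; inside; outside; ∁; ∣_∣) renaming (⊥ to ∅; _∈_ to _∈ˢ_; _∉_ to _∉ˢ_)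
import Data.Fin.Subset.Properties as Subsetₚ
open import Data.List using (List; []; _∷_; _++_; length; map; filter; lookup; allFin; applyUpTo; applyDownFrom; cartesianProductWith)
open import Data.List.Membership.Propositional using (_∈_; _∉_; find; lose)
open import Data.List.Membership.Propositional.Properties
  using (∈-++⁺ˡ; ∈-++⁺ʳ; ∈-map⁺; ∈-allFin; ∈-applyUpTo⁺; ∈-applyUpTo⁻; ∈-applyDownFrom⁻;
         ∈-cartesianProductWith⁺; ∈-filter⁺; ∈-filter⁻; ∈-length)
open import Data.List.Membership.Propositional.Properties.WithK using (unique∧set⇒bag)
open import Data.List.Properties
  using (length-++; length-map; length-tabulate; length-applyUpTo; length-applyDownFrom; ++-assoc; filter-notAll)
open import Data.List.Relation.Binary.BagAndSetEquality using (∼bag⇒↭)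
open import Data.List.Relation.Binary.Permutation.Propositional.Properties using (↭-length)
open import Data.List.Relation.Unary.All as All using (All; []; _∷_)
import Data.List.Relation.Unary.All.Properties as Allₚ
open import Data.List.Relation.Unary.AllPairs using ([]; _∷_)
open import Data.List.Relation.Unary.Any using (here; there; any?; index)
open import Data.List.Relation.Unary.Any.Properties using (lookup-index)
open import Data.List.Relation.Unary.Unique.Propositional using (Unique)
import Data.List.Relation.Unary.Unique.Propositional.Properties as Uniqueₚ
open import Data.Maybe using (Maybe; just; nothing)
open import Data.Maybe.Properties using (just-injective; ≡-dec)
import Data.Nat as ℕ
open import Data.Nat using (ℕ; zero; suc; _+_; _*_; _∸_; _≤_; _<_; _≤?_; z≤n; s≤s; z<s; s<s; s≤s⁻¹)
open import Data.Nat.Combinatorics using (_C_; nC1≡n; nCk+nC[k+1]≡[n+1]C[k+1])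
open import Data.Nat.DivMod using (_%_; _/_; m%n<n; m<n⇒m%n≡m; m≡m%n+[m/n]*n; [m+kn]%n≡m%n; [m+n]%n≡m%n)
open import Data.Nat.Properties
open import Data.Product using (Σ-syntax; ∃-syntax; _×_; _,_; proj₁; proj₂)
open import Data.Sum using (_⊎_; inj₁; inj₂; [_,_]′)
open import Data.Sum.Properties using (inj₁-injective; inj₂-injective)
open import Data.Unit using (⊤; tt)
open import Data.Vec using ([]; _∷_; here; there; _[_]≔_)
open import Data.Vec.Properties using ([]≔-updates; []≔-minimal)
open import Function using (_∘_; id; const; _↣_; Injection; Injective; mk↣; mk⇔)
open import Relation.Binary using (DecidableEquality; tri<; tri≈; tri>)
open import Relation.Binary.PropositionalEquality
  using (_≡_; _≢_; refl; sym; trans; cong; cong₂; subst; subst₂; ≢-sym; module ≡-Reasoning)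
open import Relation.Nullary using (¬_; Dec; yes; no; ¬?; _×-dec_; contradiction)
open import Relation.Nullary.Decidable using (decidable-stable)

-- Cycles in a star-coloured complete graph.

module StarColoured {V X : Set} (_≟_ : DecidableEquality V) (_≟ˣ_ : DecidableEquality X)
  (col : V → V → X) (col-sym : ∀ x y → col x y ≡ col y x)
  (centre : ∀ {x y} → x ≢ y → ∃[ z ] (∀ {u v} → u ≢ v → col u v ≡ col x y → z ≡ u ⊎ z ≡ v))
  where

  open import Data.List.Membership.DecPropositional _≟_ using (_∈?_)
  open import Data.List.Relation.Unary.Unique.DecPropositional _≟_ using (unique?)

  -- The common vertex of all edges of this colour lies on both `a b` and `a c`, and `b` and `c`
  -- differ, so it is `a`. Most contradictions below come from an edge that misses such a forced
  -- centre.
  fork : ∀ {a b c u v} → a ≢ b → a ≢ c → b ≢ c → col a b ≡ col a c →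
         u ≢ v → a ≢ u → a ≢ v → col u v ≢ col a b
  fork a≢b a≢c b≢c ab≡ac u≢v a≢u a≢v uv≡ab with centre a≢b
  ... | z , covers with covers a≢b refl | covers a≢c (sym ab≡ac) | covers u≢v uv≡ab
  ... | inj₁ refl | _         | inj₁ refl = a≢u refl
  ... | inj₁ refl | _         | inj₂ refl = a≢v refl
  ... | inj₂ refl | inj₁ refl | _         = a≢b refl
  ... | inj₂ refl | inj₂ refl | _         = b≢c refl

  Walk : V → V → List V → Set
  Walk a b []       = ⊤
  Walk a b (c ∷ cs) = col a b ≢ col b c × Walk b c cs

  -- Repeating `a` and `b` at the end makes `Walk` compare the edges at the last vertex and at `a`
  -- as well. Only consecutive edges are compared; `proper⇒rainbow` derives rainbowness from that.
  IsCycle : List V → Set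
  IsCycle (a ∷ b ∷ cs) = Unique (a ∷ b ∷ cs) × Walk a b (cs ++ a ∷ b ∷ [])
  IsCycle _            = ⊥

  walk? : ∀ a b cs → Dec (Walk a b cs)
  walk? a b []       = yes tt
  walk? a b (c ∷ cs) = ¬? (col a b ≟ˣ col b c) ×-dec walk? b c cs

  isCycle? : ∀ L → Dec (IsCycle L)
  isCycle? []           = no λ ()
  isCycle? (_ ∷ [])     = no λ ()
  isCycle? (a ∷ b ∷ cs) = unique? (a ∷ b ∷ cs) ×-dec walk? a b (cs ++ a ∷ b ∷ [])

  record CycleIn (R : List V) (m : ℕ) (L : List V) : Set where
    constructor cycleIn
    field
      length≡ : length L ≡ m
      within  : All (_∈ R) L
      isCycle : IsCycle L

  Acyclic : List V → ℕ → Set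
  Acyclic R m = ∀ L → ¬ CycleIn R m L

  words : List V → ℕ → List (List V)
  words R zero    = [] ∷ []
  words R (suc m) = cartesianProductWith _∷_ R (words R m)

  ∈-words : ∀ {R} L → All (_∈ R) L → L ∈ words R (length L)
  ∈-words []      []       = here refl
  ∈-words (x ∷ L) (p ∷ ps) = ∈-cartesianProductWith⁺ _∷_ p (∈-words L ps)

  -- Only finitely many lists of length `m` have all entries in `R`, so searching `words R m`
  -- decides constructively whether a cycle exists.
  cycle⊎acyclic : ∀ R m → (∃[ L ] CycleIn R m L) ⊎ Acyclic R m
  cycle⊎acyclic R m with any? cycleIn? (words R m)
    where
    cycleIn? : ∀ L → Dec (CycleIn R m L)
    cycleIn? L with length L ℕ.≟ m | All.all? (_∈? R) L | isCycle? L
    ... | yes p | yes q | yes r = yes (cycleIn p q r)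
    ... | no ¬p | _     | _     = no (¬p ∘ CycleIn.length≡)
    ... | _     | no ¬q | _     = no (¬q ∘ CycleIn.within)
    ... | _     | _     | no ¬r = no (¬r ∘ CycleIn.isCycle)
  ... | yes some = inj₁ (let L , _ , c = find some in L , c)
  ... | no none  = inj₂ λ { L c@(cycleIn refl ins _) → none (lose (∈-words L ins) c) }

  -- Cycles as periodic sequences, rotated and reversed.

  record Periodic (m : ℕ) (f : ℕ → V) : Set where
    field
      period    : ∀ i → f (m + i) ≡ f i
      injective : ∀ {i j} → i < m → j < m → f i ≡ f j → i ≡ j
      proper    : ∀ i → col (f i) (f (1 + i)) ≢ col (f (1 + i)) (f (2 + i))

  open Periodic

  private
    nth : V → List V → ℕ → V
    nth d []       _       = d
    nth d (x ∷ xs) zero    = x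
    nth d (x ∷ xs) (suc i) = nth d xs i

    nth-++ˡ : ∀ {d} xs {ys i} → i < length xs → nth d (xs ++ ys) i ≡ nth d xs i
    nth-++ˡ (x ∷ xs) {i = zero}  _       = refl
    nth-++ˡ (x ∷ xs) {i = suc i} (s≤s p) = nth-++ˡ xs p

    nth-++ʳ : ∀ {d} xs {ys} i → nth d (xs ++ ys) (length xs + i) ≡ nth d ys i
    nth-++ʳ []       i = refl
    nth-++ʳ (x ∷ xs) i = nth-++ʳ xs i

    nth-∈ : ∀ {d} xs {i} → i < length xs → nth d xs i ∈ xs
    nth-∈ (x ∷ xs) {zero}  _       = here refl
    nth-∈ (x ∷ xs) {suc i} (s≤s p) = there (nth-∈ xs p)

    nth-injective : ∀ {d xs} → Unique xs → ∀ {i j} → i < length xs → j < length xs →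
                    nth d xs i ≡ nth d xs j → i ≡ j
    nth-injective (_ ∷ _)  {zero}  {zero}  _       _       _ = refl
    nth-injective (p ∷ _)  {zero}  {suc j} _       (s≤s q) e =
      contradiction e (All.lookup p (nth-∈ _ q))
    nth-injective (p ∷ _)  {suc i} {zero}  (s≤s q) _       e =
      contradiction (sym e) (All.lookup p (nth-∈ _ q))
    nth-injective (_ ∷ us) {suc i} {suc j} (s≤s p) (s≤s q) e = cong suc (nth-injective us p q e)

    nth-walk : ∀ {d a b} cs → Walk a b cs → ∀ {i} → i < length cs → let E = a ∷ b ∷ cs in
               col (nth d E i) (nth d E (1 + i)) ≢ col (nth d E (1 + i)) (nth d E (2 + i))
    nth-walk (c ∷ cs) (w , _)  {zero}  _       = w
    nth-walk (c ∷ cs) (_ , ws) {suc i} (s≤s p) = nth-walk cs ws p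

  -- Indexing the cycle by all natural numbers turns rotations into shifts, so that later arguments
  -- can look at `f 0` and its neighbours without residues.
  unroll : ∀ {R m L} → CycleIn R m L → ∃[ f ] (Periodic m f × (∀ i → f i ∈ R))
  unroll {L = L@(a ∷ b ∷ cs)} (cycleIn refl ins (uniq , walk)) = f , record
    { period    = per
    ; injective = λ p q e → nth-injective uniq p q (trans (sym (f-small p)) (trans e (f-small q)))
    ; proper    = λ i → subst₂ _≢_ (cong₂ col (reduce 0 i) (reduce 1 i)) (cong₂ col (reduce 1 i) (reduce 2 i))
                          (proper-small (m%n<n i m))
    } , λ i → All.lookup ins (nth-∈ L (m%n<n i m))
    where
    m = length L
    -- `E` agrees with `f` up to index `m + 1`, the last index to which the walk condition of the
    -- cycle refers.
    E = L ++ a ∷ b ∷ []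
    f : ℕ → V
    f i = nth a L (i % m)
    f-small : ∀ {i} → i < m → f i ≡ nth a L i
    f-small i<m = cong (nth a L) (m<n⇒m%n≡m i<m)
    per : ∀ i → f (m + i) ≡ f i
    per i = cong (nth a L) (trans (cong (_% m) (+-comm m i)) ([m+n]%n≡m%n i m))
    reduce : ∀ d i → f (d + i % m) ≡ f (d + i)
    reduce d i = cong (nth a L) (begin
      (d + i % m) % m                   ≡⟨ [m+kn]%n≡m%n (d + i % m) (i / m) m ⟨
      (d + i % m + i / m * m) % m       ≡⟨ cong (_% m) (+-assoc d (i % m) _) ⟩
      (d + (i % m + i / m * m)) % m     ≡⟨ cong (λ z → (d + z) % m) (m≡m%n+[m/n]*n i m) ⟨
      (d + i) % m                       ∎)
      where open ≡-Reasoning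
    beyond : ∀ i → i < 2 → nth a E (m + i) ≡ f (m + i)
    beyond i p = trans (nth-++ʳ L i) (trans (initial i p) (sym (per i)))
      where
      initial : ∀ i → i < 2 → nth a (a ∷ b ∷ []) i ≡ f i
      initial 0 _ = sym (f-small z<s)
      initial 1 _ = sym (f-small (s<s z<s))
      initial (suc (suc _)) (s≤s (s≤s ()))
    nth-E : ∀ i → i < m + 2 → nth a E i ≡ f i
    nth-E i p with m ≤? i
    ... | no  m≰i = trans (nth-++ˡ L (≰⇒> m≰i)) (sym (f-small (≰⇒> m≰i)))
    ... | yes m≤i = subst (λ z → nth a E z ≡ f z) (m+[n∸m]≡n m≤i)
                      (beyond (i ∸ m) (+-cancelˡ-< m _ _ (subst (_< m + 2) (sym (m+[n∸m]≡n m≤i)) p)))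
    proper-small : ∀ {r} → r < m → col (f r) (f (1 + r)) ≢ col (f (1 + r)) (f (2 + r))
    proper-small {r} r<m =
      subst₂ _≢_ (cong₂ col (nth-E r (<-≤-trans r<m (m≤m+n m 2))) e₁) (cong₂ col e₁ (nth-E (2 + r) lt₂))
        (nth-walk (cs ++ a ∷ b ∷ []) walk (subst (r <_) (sym len) r<m))
      where
      lt₂ : 2 + r < m + 2
      lt₂ = subst (2 + r <_) (+-comm 2 m) (+-monoʳ-< 2 r<m)
      e₁ = nth-E (1 + r) (<-trans (n<1+n _) lt₂)
      len : length (cs ++ a ∷ b ∷ []) ≡ m
      len = trans (length-++ cs) (+-comm (length cs) 2)

  closing : ∀ {m f} → Periodic m f → f m ≡ f 0
  closing {m} {f} P = trans (cong f (sym (+-identityʳ m))) (period P 0)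

  private
    shift₁ : ∀ {m f} → Periodic m f → Periodic m (f ∘ suc)
    shift₁ {m} {f} P = record
      { period    = λ i → trans (cong f (sym (+-suc m i))) (period P (suc i))
      ; injective = inj
      ; proper    = λ i → proper P (suc i)
      }
      where
      -- Only the last index of the shifted window leaves the original one; there `f m` is `f 0`.
      inj : ∀ {i j} → i < m → j < m → f (suc i) ≡ f (suc j) → i ≡ j
      inj p q e with m≤n⇒m<n∨m≡n p | m≤n⇒m<n∨m≡n q
      ... | inj₁ p′   | inj₁ q′   = suc-injective (injective P p′ q′ e)
      ... | inj₂ refl | inj₂ q′   = sym (suc-injective q′)
      ... | inj₁ p′   | inj₂ refl = contradiction (injective P p′ z<s (trans e (closing P))) λ ()
      ... | inj₂ refl | inj₁ q′   = contradiction (injective P q′ z<s (trans (sym e) (closing P))) λ ()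

  shift : ∀ {m f} r → Periodic m f → Periodic m (λ i → f (i + r))
  shift {m} {f} r P = record
    { period    = λ i → trans (cong f (+-assoc m i r)) (period P (i + r))
    ; injective = inj r P
    ; proper    = λ i → proper P (i + r)
    }
    where
    inj : ∀ {f} r → Periodic m f → ∀ {i j} → i < m → j < m → f (i + r) ≡ f (j + r) → i ≡ j
    inj {f} zero    P {i} {j} p q e =
      injective P p q (subst₂ (λ a b → f a ≡ f b) (+-identityʳ i) (+-identityʳ j) e)
    inj {f} (suc r) P {i} {j} p q e =
      inj r (shift₁ P) p q (subst₂ (λ a b → f a ≡ f b) (+-suc i r) (+-suc j r) e)

  period* : ∀ {m f} → Periodic m f → ∀ q i → f (q * m + i) ≡ f i
  period* P zero    i = refl
  period* {m} {f} P (suc q) i =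
    trans (cong f (+-assoc m (q * m) i)) (trans (period P (q * m + i)) (period* P q i))

  -- Since m′ ≡ -1 modulo suc m′, this is the cycle traversed backwards.
  backwards : ℕ → (ℕ → V) → ℕ → V
  backwards m′ f i = f (m′ * i)

  module _ {m′ f} (P : Periodic (suc m′) f) where

    -- The index `suc (m′ * suc i)` exceeds `m′ * i` by one full period. Thus a step of `backwards`
    -- undoes a step of `f`.
    backwards-step : ∀ i → backwards m′ f i ≡ f (suc (m′ * suc i))
    backwards-step i = sym (trans (cong (f ∘ suc) (*-suc m′ i)) (period P (m′ * i)))

    private
      -- This replaces the index by its residue in the first period, where `f` is injective.
      backwards-suc : ∀ {e} → e ≤ m′ → backwards m′ f (suc e) ≡ f (m′ ∸ e)
      backwards-suc {e} e≤m′ = trans (cong f eq) (period* P e (m′ ∸ e))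
        where
        eq : m′ * suc e ≡ e * suc m′ + (m′ ∸ e)
        eq = begin
          m′ * suc e              ≡⟨ *-suc m′ e ⟩
          m′ + m′ * e             ≡⟨ cong₂ _+_ (sym (m+[n∸m]≡n e≤m′)) (*-comm m′ e) ⟩
          e + (m′ ∸ e) + e * m′   ≡⟨ +-assoc e _ _ ⟩
          e + ((m′ ∸ e) + e * m′) ≡⟨ cong (e +_) (+-comm (m′ ∸ e) _) ⟩
          e + (e * m′ + (m′ ∸ e)) ≡⟨ +-assoc e _ _ ⟨
          e + e * m′ + (m′ ∸ e)   ≡⟨ cong (_+ (m′ ∸ e)) (*-suc e m′) ⟨
          e * suc m′ + (m′ ∸ e)   ∎
          where open ≡-Reasoning

      0≢backwards-suc : ∀ {e} → e < m′ → f (m′ * 0) ≢ f (m′ * suc e)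
      0≢backwards-suc {e} e<m′ eq with injective P z<s (s≤s (m∸n≤m m′ e))
        (trans (cong f (sym (*-zeroʳ m′))) (trans eq (backwards-suc (<⇒≤ e<m′))))
      ... | z = contradiction (sym z) (m>n⇒m∸n≢0 e<m′)

    backwards-periodic : Periodic (suc m′) (backwards m′ f)
    backwards-periodic = record
      { period    = λ i → trans (cong f (*-distribˡ-+ m′ (suc m′) i)) (period* P m′ (m′ * i))
      ; injective = inj
      ; proper    = prop
      }
      where
      inj : ∀ {i j} → i < suc m′ → j < suc m′ → f (m′ * i) ≡ f (m′ * j) → i ≡ j
      inj {zero}  {zero}  _       _       _ = refl
      inj {zero}  {suc j} _       (s≤s q) e = contradiction e (0≢backwards-suc q)
      inj {suc i} {zero}  (s≤s p) _       e = contradiction (sym e) (0≢backwards-suc p)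
      inj {suc i} {suc j} (s≤s p) (s≤s q) e = cong suc (∸-cancelˡ-≡ (<⇒≤ p) (<⇒≤ q)
        (injective P (s≤s (m∸n≤m m′ i)) (s≤s (m∸n≤m m′ j))
          (trans (sym (backwards-suc (<⇒≤ p))) (trans e (backwards-suc (<⇒≤ q))))))
      prop : ∀ i → col (f (m′ * i)) (f (m′ * suc i)) ≢ col (f (m′ * suc i)) (f (m′ * suc (suc i)))
      prop i e = proper P j (begin
        col (f j) (f (1 + j))                        ≡⟨ cong (col (f j)) (backwards-step (suc i)) ⟨
        col (f j) (f (m′ * suc i))                   ≡⟨ col-sym _ _ ⟩
        col (f (m′ * suc i)) (f j)                   ≡⟨ e ⟨
        col (f (m′ * i)) (f (m′ * suc i))            ≡⟨ col-sym _ _ ⟩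
        col (f (m′ * suc i)) (f (m′ * i))            ≡⟨ cong₂ col (backwards-step (suc i)) two ⟩
        col (f (1 + j)) (f (2 + j))                  ∎)
        where
        open ≡-Reasoning
        j = m′ * suc (suc i)
        two : f (m′ * i) ≡ f (2 + j)
        two = trans (backwards-step i) (sym (trans
          (cong f (trans (cong (2 +_) (*-suc m′ (suc i))) (cong suc (sym (+-suc m′ _)))))
          (period P (suc (m′ * suc i)))))

  -- Splicing segments of cycles; vertices off a cycle that cannot be lengthened.

  apart : ∀ {m f} → Periodic m f → ∀ {i j} → i < j → ∀ r → j < m → f (i + r) ≢ f (j + r)
  apart P i<j r j<m e = <⇒≢ i<j (injective (shift r P) (<-trans i<j j<m) j<m e)

  arc-unique : ∀ {m f n} → Periodic m f → n ≤ m → Unique (applyUpTo f n)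
  arc-unique {f = f} {n} P n≤m = Uniqueₚ.applyUpTo⁺₁ f n λ i<j j<n e →
    <⇒≢ i<j (injective P (<-trans i<j (<-≤-trans j<n n≤m)) (<-≤-trans j<n n≤m) e)

  -- For building new cycles: a segment of a periodic sequence is entered from `p` and continued by
  -- `rest`, so only the two junctions remain to be checked.
  arc-walk : ∀ {g} → (∀ i → col (g i) (g (1 + i)) ≢ col (g (1 + i)) (g (2 + i))) →
             ∀ n {p rest} → col p (g 0) ≢ col (g 0) (g 1) → Walk (g n) (g (1 + n)) rest →
             Walk p (g 0) (applyUpTo (g ∘ suc) (suc n) ++ rest)
  arc-walk proper zero    p≢ w = p≢ , w
  arc-walk proper (suc n) p≢ w = p≢ , arc-walk (proper ∘ suc) n (proper 0) w

  -- For `x` off the cycle, each arc and the edge from its tail to `x` form a fork, so the colour of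
  -- the arc is centred at its tail.
  Follows : V → (ℕ → V) → Set
  Follows x f = ∀ i → col x (f i) ≡ col (f i) (f (1 + i))

  Monochromatic : V → (ℕ → V) → Set
  Monochromatic x f = ∀ i → col x (f i) ≡ col x (f 0)

  Off : V → (ℕ → V) → Set
  Off x f = ∀ i → x ≢ f i

  -- Each edge of `R` not inside `R′` gets the `φ`-colour of a peeled end. Distinct peeled vertices
  -- may share a colour here; their distinctness comes out of the count in the equality case.
  record Peel (R R′ : List V) : Set where
    field
      φ       : V → X
      out     : ∀ {a r} → a ∈ R → a ∉ R′ → r ∈ R′ → col a r ≡ φ a
      between : ∀ {a b} → a ∈ R → a ∉ R′ → b ∈ R → b ∉ R′ → a ≢ b → col a b ≡ φ a ⊎ col a b ≡ φ b

  module _ {R l} (acyclic : Acyclic R (4 + l)) where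

    private
      m = 3 + l

    module OnCycle {f} (P : Periodic m f) (f∈ : ∀ i → f i ∈ R) where

      next≢ : ∀ i → f i ≢ f (1 + i)
      next≢ i = apart P z<s i (s<s z<s)

      -- Otherwise `x` fits between `f 0` and `f 1`: the three inequalities are the conditions at
      -- `f 0`, `x` and `f 1` in a cycle of length `4 + l`. The vertex before `f 0` is `f (2 + l)`.
      insertion : ∀ {x} → x ∈ R → Off x f →
                  col x (f 0) ≡ col (f (2 + l)) (f 0) ⊎
                  col x (f 0) ≡ col x (f 1) ⊎
                  col x (f 1) ≡ col (f 1) (f 2)
      insertion {x} x∈ off with col x (f 0) ≟ˣ col (f (2 + l)) (f 0) | col x (f 0) ≟ˣ col x (f 1) | col x (f 1) ≟ˣ col (f 1) (f 2)
      ... | yes p | _     | _     = inj₁ p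
      ... | _     | yes q | _     = inj₂ (inj₁ q)
      ... | _     | _     | yes r = inj₂ (inj₂ r)
      ... | no ¬p | no ¬q | no ¬r = ⊥-elim (acyclic (x ∷ applyUpTo (f ∘ suc) m) record
        { length≡ = cong suc (length-applyUpTo (f ∘ suc) m)
        ; within  = x∈ ∷ Allₚ.applyUpTo⁺₂ (f ∘ suc) m (λ i → f∈ (suc i))
        ; isCycle = Allₚ.applyUpTo⁺₂ (f ∘ suc) m (λ i → off (suc i)) ∷ arc-unique (shift₁ P) ≤-refl
                  , arc-walk (proper P ∘ suc) (suc l) ¬r
                      ( (λ e → ¬p (trans (col-sym _ _) (subst (λ z → col z x ≡ col (f (2 + l)) z) (closing P) (sym e))))
                      , (λ e → ¬q (trans (col-sym _ _) (subst (λ z → col z x ≡ col x (f 1)) (closing P) e)))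
                      , tt )
        })

      -- Replacing `f 0` by the edge `y x` lengthens the cycle by one. The four inequalities are the
      -- conditions at `x`, `f 1`, `f (2 + l)` and `y`.
      bridge : ∀ {x y} → x ∈ R → y ∈ R → Off x f → Off y f → y ≢ x →
               col y x ≢ col x (f 1) → col x (f 1) ≢ col (f 1) (f 2) →
               col (f (1 + l)) (f (2 + l)) ≢ col (f (2 + l)) y → col (f (2 + l)) y ≢ col y x → ⊥
      bridge {x} {y} x∈ y∈ offx offy y≢x h₁ h₂ h₃ h₄ = acyclic (y ∷ x ∷ applyUpTo (f ∘ suc) (2 + l)) record
        { length≡ = cong (2 +_) (length-applyUpTo (f ∘ suc) (2 + l))
        ; within  = y∈ ∷ x∈ ∷ Allₚ.applyUpTo⁺₂ (f ∘ suc) (2 + l) (λ i → f∈ (suc i))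
        ; isCycle = (y≢x ∷ Allₚ.applyUpTo⁺₂ (f ∘ suc) (2 + l) (λ i → offy (suc i)))
                    ∷ Allₚ.applyUpTo⁺₂ (f ∘ suc) (2 + l) (λ i → offx (suc i))
                    ∷ arc-unique (shift₁ P) (n≤1+n _)
                  , h₁ , arc-walk (proper P ∘ suc) l h₂ (h₃ , h₄ , tt)
        }

      monochromatic-fork : ∀ {x i j c} → Off x f → Monochromatic x f → f i ≢ f j → col (f i) (f j) ≢ col x (f c)
      monochromatic-fork {x} {i} {j} {c} off mono i≢j e =
        fork (off 0) (off 1) (next≢ 0) (sym (mono 1)) i≢j (off i) (off j) (trans e (mono c))

      follows⇒¬monochromatic : ∀ {x} → Off x f → Follows x f → ¬ Monochromatic x f
      follows⇒¬monochromatic off fol mono = monochromatic-fork off mono (next≢ 0) (sym (fol 0))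

      -- With a third colour on `x y`, `bridge` would apply: the colours that `x` and `y` send to
      -- the cycle are centred at `x` and `y`, hence occur on no arc of it.
      monochromatic-pair : ∀ {x y} → x ∈ R → y ∈ R → Off x f → Off y f → x ≢ y →
                           Monochromatic x f → Monochromatic y f →
                           col x y ≡ col x (f 0) ⊎ col x y ≡ col y (f 0)
      monochromatic-pair {x} {y} x∈ y∈ offx offy x≢y mx my
        with col x y ≟ˣ col x (f 0) | col x y ≟ˣ col y (f 0)
      ... | yes p | _     = inj₁ p
      ... | _     | yes q = inj₂ q
      ... | no ¬p | no ¬q = ⊥-elim (bridge x∈ y∈ offx offy (≢-sym x≢y)
        (λ e → ¬p (trans (col-sym x y) (trans e (mx 1))))
        (≢-sym (monochromatic-fork offx mx (next≢ 1)))
        (λ e → monochromatic-fork offy my (next≢ (1 + l)) (trans e (col-sym _ _)))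
        (λ e → ¬q (trans (col-sym x y) (trans (sym e) (trans (col-sym _ _) (my (2 + l)))))))

      -- If the colours differed, `bridge` with `d` in the role of `y` would apply. The edge from
      -- `f (2 + l)` to `d` has the colour of the arc leaving `f (2 + l)`, so it differs from the
      -- preceding arc; and its colour is centred at `f (2 + l)`, so it differs from that of `d x`.
      monochromatic-follows : ∀ {x d} → x ∈ R → d ∈ R → Off x f → Off d f → x ≢ d →
                              Monochromatic x f → Follows d f → col x d ≡ col x (f 0)
      monochromatic-follows {x} {d} x∈ d∈ offx offd x≢d mx fd with col x d ≟ˣ col x (f 0)
      ... | yes p = p
      ... | no ¬p = ⊥-elim (bridge x∈ d∈ offx offd (≢-sym x≢d)
        (λ e → ¬p (trans (col-sym x d) (trans e (mx 1))))
        (≢-sym (monochromatic-fork offx mx (next≢ 1)))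
        (λ e → proper P (1 + l) (trans e (trans (col-sym _ _) (fd (2 + l)))))
        (λ e → fork (offd (2 + l)) (≢-sym x≢d) (≢-sym (offx (2 + l))) (trans (col-sym _ _) e)
                 (next≢ (2 + l)) (offd _) (offd _) (sym (fd (2 + l)))))

      -- Otherwise there is the rainbow cycle d ← f j ← ⋯ ← f 0 — f (1 + j) → ⋯ → f (2 + l) → d.
      chord : ∀ {d} → d ∈ R → Off d f → Follows d f → ∀ j q → suc j + suc q ≡ m →
              col (f 0) (f (suc j)) ≡ col (f 0) d ⊎ col (f 0) (f (suc j)) ≡ col (f (suc j)) d
      chord {d} d∈ off fol j q sum
        with col (f 0) (f (suc j)) ≟ˣ col (f 0) d | col (f 0) (f (suc j)) ≟ˣ col (f (suc j)) d
      ... | yes p | _     = inj₁ p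
      ... | _     | yes p = inj₂ p
      ... | no ¬p | no ¬q = ⊥-elim (acyclic (d ∷ down ++ up) record
        { length≡ = cong suc (trans (length-++ down) (trans (cong₂ _+_ (length-applyDownFrom f (suc j)) (length-applyUpTo g (suc q))) sum))
        ; within  = d∈ ∷ Allₚ.++⁺ (Allₚ.applyDownFrom⁺₂ f (suc j) f∈) (Allₚ.applyUpTo⁺₂ g (suc q) (λ i → f∈ (i + suc j)))
        ; isCycle = Allₚ.++⁺ (Allₚ.applyDownFrom⁺₂ f (suc j) off) (Allₚ.applyUpTo⁺₂ g (suc q) (λ i → off (i + suc j)))
                    ∷ Uniqueₚ.++⁺ down-unique up-unique disjoint
                  , subst (Walk d (f j)) (sym (++-assoc (applyDownFrom f j) up _)) (descent j (col-sym _ _) turn)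
        })
        where
        g : ℕ → V
        g i = f (i + suc j)
        down = applyDownFrom f (suc j)
        up   = applyUpTo g (suc q)
        sj≤m : suc j ≤ m
        sj≤m = subst (suc j ≤_) sum (m≤m+n (suc j) (suc q))
        sq≤m : suc q ≤ m
        sq≤m = subst (suc q ≤_) sum (m≤n+m (suc q) (suc j))
        down-unique : Unique down
        down-unique = Uniqueₚ.applyDownFrom⁺₁ f (suc j) λ a<b b≤j e →
          <⇒≢ a<b (sym (injective P (<-≤-trans b≤j sj≤m) (<-≤-trans (<-trans a<b b≤j) sj≤m) e))
        up-unique : Unique up
        up-unique = arc-unique (shift (suc j) P) sq≤m
        disjoint : ∀ {v} → ¬ (v ∈ down × v ∈ up)
        disjoint (p , r) with ∈-applyDownFrom⁻ f p | ∈-applyUpTo⁻ g r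
        ... | a , a≤j , refl | b , b≤q , e =
          <⇒≢ (<-≤-trans a≤j (m≤n+m (suc j) b))
            (injective P (<-≤-trans a≤j sj≤m) (subst (b + suc j <_) (trans (+-comm (suc q) (suc j)) sum) (+-monoˡ-< (suc j) b≤q)) e)
        toward : ∀ i → col (f i) d ≡ col (f i) (f (1 + i))
        toward i = trans (col-sym _ _) (fol i)
        -- The invariant gives the edge entering `f j` the colour of `f j` to `d`. It holds
        -- trivially when `p` is `d`, and by `toward` when `p` is `f (1 + j)`.
        descent : ∀ j {p rest} → col p (f j) ≡ col (f j) d →
                  (∀ {p} → col p (f 0) ≡ col (f 0) d → Walk p (f 0) rest) →
                  Walk p (f j) (applyDownFrom f j ++ rest)
        descent zero    e k = k e
        descent (suc j) e k =
          (λ e′ → proper P j (trans (col-sym _ _) (trans (sym e′) (trans e (toward (suc j))))))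
          , descent j (trans (col-sym _ _) (sym (toward j))) k
        last≢ : ∀ q → suc j + suc q ≡ m → col (g q) d ≢ col d (f j)
        last≢ q sum e = fork (off (q + suc j)) (off j) g≢f (trans (col-sym _ _) e)
          (next≢ (q + suc j)) (off _) (off _) (sym (fol (q + suc j)))
          where
          g≢f : g q ≢ f j
          g≢f e = <⇒≢ (m≤n+m (suc j) q) (sym (injective P
            (subst (q + suc j <_) (trans (+-comm (suc q) (suc j)) sum) ≤-refl) sj≤m e))
        -- After `g 0`, which is `f (suc j)`, comes either `d` itself or, by `toward`, an arc with
        -- the colour of the edge to `d`; in both cases `¬q` is the condition needed.
        ending : ∀ q → suc j + suc q ≡ m → Walk (f 0) (g 0) (applyUpTo (g ∘ suc) q ++ d ∷ f j ∷ [])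
        ending zero    sum = ¬q , last≢ 0 sum , tt
        ending (suc q) sum = arc-walk (λ i → proper P (i + suc j)) q
          (λ e → ¬q (trans e (sym (toward (suc j)))))
          ((λ e → proper P (q + suc j) (trans e (toward (suc q + suc j)))) , last≢ (suc q) sum , tt)
        turn : ∀ {p} → col p (f 0) ≡ col (f 0) d → Walk p (f 0) (up ++ d ∷ f j ∷ [])
        turn e = (λ e′ → ¬p (trans (sym e′) e)) , ending q sum

    -- The three kinds of vertices off the cycle.

    module _ {f} (P : Periodic m f) (f∈ : ∀ i → f i ∈ R) where
      open OnCycle P f∈

      trichotomy : ∀ {x} → x ∈ R → Off x f → Monochromatic x f ⊎ Follows x f ⊎ Follows x (backwards (2 + l) f)
      trichotomy {x} x∈ off = decide
        where
        -- Ahead spreads forwards and Behind backwards along the cycle, so each holds everywhere or nowhere.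
        Ahead Behind Level : ℕ → Set
        Ahead  i = col x (f i) ≡ col (f i) (f (1 + i))
        Behind i = col x (f (1 + i)) ≡ col (f i) (f (1 + i))
        Level  i = col x (f i) ≡ col x (f (1 + i))

        -- This is `insertion` between `f (1 + i)` and `f (2 + i)`; after the rotation the preceding
        -- vertex has index `2 + l + suc i`, one period beyond `i`.
        blocked : ∀ i → Behind i ⊎ Level (1 + i) ⊎ Ahead (2 + i)
        blocked i = subst (λ v → col x (f (1 + i)) ≡ col v (f (1 + i)) ⊎ Level (1 + i) ⊎ Ahead (2 + i))
          (trans (cong f (+-suc (2 + l) i)) (period P i))
          (OnCycle.insertion (shift (suc i) P) (λ j → f∈ (j + suc i)) x∈ (λ j → off (j + suc i)))

        level-fork : ∀ {i a b} → Level i → f a ≢ f b → col (f a) (f b) ≢ col x (f i)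
        level-fork {i} lev a≢b = fork (off i) (off (1 + i)) (next≢ i) lev a≢b (off _) (off _)

        around : ∀ (Q : V → V → Set) q i → Q (f i) (f (1 + i)) → Q (f (q * m + i)) (f (1 + (q * m + i)))
        around Q q i = subst₂ Q (sym (period* P q i)) (sym (trans (cong f (sym (+-suc (q * m) i))) (period* P q (suc i))))

        around⁻ : ∀ (Q : V → V → Set) q i → Q (f (q * m + i)) (f (1 + (q * m + i))) → Q (f i) (f (1 + i))
        around⁻ Q q i = subst₂ Q (period* P q i) (trans (cong f (sym (+-suc (q * m) i))) (period* P q (suc i)))

        -- The index `i * m` is at least `i` and stands for `f 0`, so spreading forwards from `i`
        -- reaches `f 0`, and spreading backwards from there reaches `i`.
        whole-turns : ∀ i → (i * m ∸ i) + i ≡ i * m + 0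
        whole-turns i = trans (m∸n+n≡m (m≤m*n i m)) (sym (+-identityʳ _))

        ahead-step′ : ∀ i → Ahead (1 + i) → Ahead (2 + i)
        ahead-step′ i p with blocked i
        ... | inj₁ q        = ⊥-elim (proper P i (trans (sym q) p))
        ... | inj₂ (inj₁ q) = ⊥-elim (level-fork q (next≢ (1 + i)) (sym p))
        ... | inj₂ (inj₂ q) = q

        -- `blocked` refers to a predecessor, so `ahead-step′` starts at index 1; one full turn
        -- covers index 0 too.
        ahead-step : ∀ i → Ahead i → Ahead (1 + i)
        ahead-step i p = around⁻ Q 1 (1 + i) (subst Ahead (sym (+-suc (1 * m) i)) (ahead-step′ _ (around Q 1 i p)))
          where Q = λ a b → col x a ≡ col a b

        ahead-from : ∀ i d → Ahead i → Ahead (d + i)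
        ahead-from i zero    p = p
        ahead-from i (suc d) p = ahead-step _ (ahead-from i d p)

        ahead-never : ¬ Ahead 0 → ∀ i → ¬ Ahead i
        ahead-never ¬p i p = ¬p (around⁻ (λ a b → col x a ≡ col a b) i 0
          (subst Ahead (whole-turns i) (ahead-from i (i * m ∸ i) p)))

        behind-step : (∀ i → ¬ Ahead i) → ∀ i → Behind (1 + i) → Behind i
        behind-step ¬ahead i p with blocked i
        ... | inj₁ q        = q
        ... | inj₂ (inj₁ q) = ⊥-elim (level-fork q (next≢ (1 + i)) (sym (trans q p)))
        ... | inj₂ (inj₂ q) = ⊥-elim (¬ahead _ q)

        behind-to : (∀ i → ¬ Ahead i) → ∀ d i → Behind (d + i) → Behind i
        behind-to ¬ahead zero    i p = p
        behind-to ¬ahead (suc d) i p = behind-to ¬ahead d i (behind-step ¬ahead _ p)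

        behind-all : (∀ i → ¬ Ahead i) → Behind 0 → ∀ i → Behind i
        behind-all ¬ahead p i = behind-to ¬ahead (i * m ∸ i) i (subst Behind (sym (whole-turns i))
          (around (λ a b → col x b ≡ col a b) i 0 p))

        decide : Monochromatic x f ⊎ Follows x f ⊎ Follows x (backwards (2 + l) f)
        decide with col x (f 0) ≟ˣ col (f 0) (f 1) | col x (f 1) ≟ˣ col (f 0) (f 1)
        ... | yes p | _ = inj₂ (inj₁ λ i → subst Ahead (+-identityʳ i) (ahead-from 0 i p))
        ... | no ¬p | yes q = inj₂ (inj₂ λ i → let j = (2 + l) * suc i in
          subst (λ v → col x v ≡ col v (f j)) (sym (backwards-step P i))
            (trans (behind-all (ahead-never ¬p) q j) (col-sym _ _)))
        -- Now neither `Ahead` nor `Behind` holds anywhere, which leaves `Level` from index 1 on;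
        -- `f 0` is reached as `f (3 + l)`.
        ... | no ¬p | no ¬q = inj₁ λ
          { zero    → refl
          ; (suc i) → trans (from-1 i) (trans (sym (from-1 (2 + l))) (cong (col x) (closing P))) }
          where
          level : ∀ i → Level (1 + i)
          level i with blocked i
          ... | inj₁ q        = ⊥-elim (¬q (behind-to (ahead-never ¬p) i 0 (subst Behind (sym (+-identityʳ i)) q)))
          ... | inj₂ (inj₁ q) = q
          ... | inj₂ (inj₂ q) = ⊥-elim (ahead-never ¬p _ q)
          from-1 : ∀ i → col x (f (suc i)) ≡ col x (f 1)
          from-1 zero    = refl
          from-1 (suc i) = trans (sym (level i)) (from-1 i)

  -- Cores and the composition of peelings.

  record Core (R : List V) : Set where
    field
      R′     : List V
      R′⊆R   : ∀ {v} → v ∈ R′ → v ∈ R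
      unique : Unique R′
      peel   : Peel R R′

  open Core

  core-refl : ∀ {R} → Unique R → Core R
  core-refl {R} u = record
    { R′ = R ; R′⊆R = id ; unique = u
    -- No vertex is peeled, so `col v v` merely supplies a value.
    ; peel = record { φ = λ v → col v v ; out = λ p q _ → contradiction p q ; between = λ p q _ _ _ → contradiction p q } }

  -- Vertices peeled in the second round still belong to `R′ c`, so an edge from the first round to
  -- the second has the colour of its end peeled first.
  core-trans : ∀ {R} (c : Core R) (d : Core (R′ c)) → Core R
  core-trans c d = record
    { R′ = R′ d ; R′⊆R = R′⊆R c ∘ R′⊆R d ; unique = unique d
    ; peel = record { φ = φ ; out = out ; between = between } }
    where
    module C = Peel (peel c)
    module D = Peel (peel d)
    φ : V → X
    φ v with v ∈? R′ c
    ... | yes _ = D.φ v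
    ... | no  _ = C.φ v
    out : ∀ {a r} → a ∈ _ → a ∉ R′ d → r ∈ R′ d → col a r ≡ φ a
    out {a} p q r with a ∈? R′ c
    ... | yes p′ = D.out p′ q r
    ... | no  q′ = C.out p q′ (R′⊆R d r)
    between : ∀ {a b} → a ∈ _ → a ∉ R′ d → b ∈ _ → b ∉ R′ d → a ≢ b → col a b ≡ φ a ⊎ col a b ≡ φ b
    between {a} {b} p q r s a≢b with a ∈? R′ c | b ∈? R′ c
    ... | yes p′ | yes r′ = D.between p′ q r′ s a≢b
    ... | yes p′ | no  s′ = inj₂ (trans (col-sym a b) (C.out r s′ p′))
    ... | no  q′ | yes r′ = inj₁ (C.out p q′ r′)
    ... | no  q′ | no  s′ = C.between p q′ r s′ a≢b

  -- Peeling with the help of a cycle one shorter than the forbidden length.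

  module _ {R l} (acyclic : Acyclic R (4 + l)) (unique-R : Unique R) where

    private
      m = 3 + l

    module _ {f} (P : Periodic m f) (f∈ : ∀ i → f i ∈ R) where
      open OnCycle acyclic P f∈

      private
        C = applyUpTo f m

        f∈C : ∀ i → f i ∈ C
        f∈C i = subst (_∈ C) (trans (sym (period* P (i / m) (i % m)))
            (cong f (trans (+-comm (i / m * m) (i % m)) (sym (m≡m%n+[m/n]*n i m)))))
          (∈-applyUpTo⁺ f (m%n<n i m))

      off : ∀ {x} → x ∉ C → Off x f
      off x∉C i refl = x∉C (f∈C i)

      -- A decidable form of `Monochromatic`, over the finite list `C`.
      UniformOn : V → Set
      UniformOn x = All (λ v → col x v ≡ col x (f 0)) C

      uniformOn? : ∀ x → Dec (UniformOn x)
      uniformOn? x = All.all? (λ v → col x v ≟ˣ col x (f 0)) C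

      monochromatic : ∀ {x} → UniformOn x → Monochromatic x f
      monochromatic u i = All.lookup u (f∈C i)

      uniformOn⁺ : ∀ {x} → Monochromatic x f → UniformOn x
      uniformOn⁺ mono = Allₚ.applyUpTo⁺₂ f m mono

      cycle-core : (∀ {x} → x ∈ R → x ∉ C → UniformOn x) → Core R
      cycle-core uniform = record
        { R′ = C ; R′⊆R = λ p → let i , _ , e = ∈-applyUpTo⁻ f p in subst (_∈ R) (sym e) (f∈ i)
        ; unique = arc-unique P ≤-refl
        ; peel = record
          { φ = λ v → col v (f 0)
          ; out = λ p q r → All.lookup (uniform p q) r
          ; between = λ p q r s a≢b → monochromatic-pair p r (off q) (off s) a≢b
              (monochromatic (uniform p q)) (monochromatic (uniform r s))
          } }

      -- By `trichotomy`, such a vertex of `R` follows the cycle in one of its two directions; this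
      -- form is decidable.
      DominatedOff : V → Set
      DominatedOff x = x ∉ C × ¬ UniformOn x

      dominatedOff? : ∀ x → Dec (DominatedOff x)
      dominatedOff? x = ¬? (x ∈? C) ×-dec ¬? (uniformOn? x)

      module _ {d} (d∈ : d ∈ R) (d∉C : d ∉ C) (fol : Follows d f) where

        -- If `x` followed the reversed cycle, the colour of the arc from `f j` to `f (suc j)` would
        -- be centred at `f j` because of `d`, and at `f (suc j)` because of `x`.
        follows-all : ∀ {x} → x ∈ R → DominatedOff x → Follows x f
        follows-all {x} x∈ (x∉C , ¬u) with trichotomy acyclic P f∈ x∈ (off x∉C)
        ... | inj₁ mono       = contradiction (uniformOn⁺ mono) ¬u
        ... | inj₂ (inj₁ fol) = fol
        ... | inj₂ (inj₂ rev) = ⊥-elim (fork (≢-sym (off x∉C (suc j))) (≢-sym (next≢ j)) (off x∉C j)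
              (trans (col-sym _ x) e) (≢-sym (off d∉C j)) (≢-sym (next≢ j)) (≢-sym (off d∉C (suc j)))
              (begin
                col (f j) d           ≡⟨ col-sym _ d ⟩
                col d (f j)           ≡⟨ fol j ⟩
                col (f j) (f (suc j)) ≡⟨ col-sym _ _ ⟩
                col (f (suc j)) (f j) ≡⟨ e ⟨
                col x (f (suc j))     ≡⟨ col-sym x _ ⟩
                col (f (suc j)) x     ∎))
          where
          open ≡-Reasoning
          -- `f (suc j)` and `f j` are the first two vertices of the reversed cycle.
          j = (2 + l) * 1
          e : col x (f (suc j)) ≡ col (f (suc j)) (f j)
          e = subst (λ v → col x v ≡ col v (f j)) (backwards-step P 0) (rev 0)

        private
          D = filter dominatedOff? R

          d∈D : d ∈ D
          d∈D = ∈-filter⁺ dominatedOff? d∈ (d∉C , λ u → follows⇒¬monochromatic (off d∉C) fol (monochromatic u))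

        -- A cycle vertex sends the colour of its outgoing arc to all of `D`, and a monochromatic
        -- vertex its single colour, so the edge to `d` represents them all. Pairs on the cycle are
        -- settled by `chord`.
        dominated-peel : Peel R D
        dominated-peel = record { φ = λ v → col v d ; out = out ; between = between }
          where
          sort : ∀ {a} → a ∈ R → a ∉ D → (∃[ i ] i < m × a ≡ f i) ⊎ (a ∉ C × Monochromatic a f)
          sort {a} a∈ a∉D with a ∈? C | uniformOn? a
          ... | yes a∈C | _     = inj₁ (∈-applyUpTo⁻ f a∈C)
          ... | no  a∉C | yes u = inj₂ (a∉C , monochromatic u)
          ... | no  a∉C | no ¬u = contradiction (∈-filter⁺ dominatedOff? a∈ (a∉C , ¬u)) a∉D
          toward : ∀ i → col (f i) d ≡ col (f i) (f (1 + i))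
          toward i = trans (col-sym _ d) (fol i)
          out : ∀ {a r} → a ∈ R → a ∉ D → r ∈ D → col a r ≡ col a d
          out {a} {r} a∈ a∉D r∈D with ∈-filter⁻ dominatedOff? r∈D | sort a∈ a∉D
          ... | r∈ , dom       | inj₁ (i , _ , refl) =
            trans (col-sym _ r) (trans (follows-all r∈ dom i) (sym (toward i)))
          ... | r∈ , dom       | inj₂ (a∉C , mono) = trans (to r∈ r∈D (proj₁ dom) (follows-all r∈ dom)) (sym (to d∈ d∈D d∉C fol))
            where
            to : ∀ {x} → x ∈ R → x ∈ D → x ∉ C → Follows x f → col a x ≡ col a (f 0)
            to x∈ x∈D x∉C = monochromatic-follows a∈ x∈ (off a∉C) (off x∉C) (λ { refl → a∉D x∈D }) mono
          to-d : ∀ {a} → a ∈ R → a ∉ D → a ∉ C → Monochromatic a f → ∀ i → col a (f i) ≡ col a d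
          to-d a∈ a∉D a∉C mono i = trans (mono i)
            (sym (monochromatic-follows a∈ d∈ (off a∉C) (off d∉C) (λ { refl → a∉D d∈D }) mono fol))
          chords : ∀ {i j} → i < j → j < m → col (f i) (f j) ≡ col (f i) d ⊎ col (f i) (f j) ≡ col (f j) d
          chords {i} {j} i<j j<m = subst (λ z → col (f i) (f z) ≡ col (f i) d ⊎ col (f i) (f z) ≡ col (f z) d) j≡
            -- Rotating by `i` makes `f i` the initial vertex; the chord then cuts the cycle into
            -- `suc p` and `m ∸ suc p` vertices.
            (OnCycle.chord acyclic (shift i P) (λ k → f∈ (k + i)) d∈ (λ k → off d∉C (k + i)) (λ k → fol (k + i))
              p (m ∸ suc (suc p)) (trans (+-suc (suc p) _) (m+[n∸m]≡n (≤-<-trans (subst (suc p ≤_) j≡ (m≤m+n (suc p) i)) j<m))))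
            where
            p = j ∸ suc i
            j≡ : suc p + i ≡ j
            j≡ = trans (sym (+-suc p i)) (m∸n+n≡m i<j)
          between : ∀ {a b} → a ∈ R → a ∉ D → b ∈ R → b ∉ D → a ≢ b → col a b ≡ col a d ⊎ col a b ≡ col b d
          between {a} {b} a∈ a∉D b∈ b∉D a≢b with sort a∈ a∉D | sort b∈ b∉D
          ... | inj₂ (a∉C , ma)    | inj₁ (j , _ , refl) = inj₁ (to-d a∈ a∉D a∉C ma j)
          ... | inj₁ (i , _ , refl) | inj₂ (b∉C , mb)    = inj₂ (trans (col-sym a b) (to-d b∈ b∉D b∉C mb i))
          ... | inj₂ (a∉C , ma)    | inj₂ (b∉C , mb)
            with monochromatic-pair a∈ b∈ (off a∉C) (off b∉C) a≢b ma mb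
          ... | inj₁ e = inj₁ (trans e (to-d a∈ a∉D a∉C ma 0))
          ... | inj₂ e = inj₂ (trans e (to-d b∈ b∉D b∉C mb 0))
          between {a} {b} a∈ a∉D b∈ b∉D a≢b | inj₁ (i , i<m , refl) | inj₁ (j , j<m , refl) with <-cmp i j
          ... | tri< i<j _ _    = chords i<j j<m
          ... | tri≈ _ refl _   = contradiction refl a≢b
          ... | tri> _ _ j<i with chords j<i i<m
          ...   | inj₁ e = inj₂ (trans (col-sym a b) e)
          ...   | inj₂ e = inj₁ (trans (col-sym a b) e)

        dominated-core : Σ[ c ∈ Core R ] (1 ≤ length (R′ c) × length (R′ c) < length R)
        dominated-core = record
          { R′ = D ; R′⊆R = proj₁ ∘ ∈-filter⁻ dominatedOff?
          ; unique = Uniqueₚ.filter⁺ dominatedOff? unique-R ; peel = dominated-peel }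
          , ∈-length d∈D
          , filter-notAll dominatedOff? R (lose (f∈ 0) λ (f0∉C , _) → f0∉C (f∈C 0))

    reduce : ∀ {f} → Periodic m f → (∀ i → f i ∈ R) →
             Σ[ c ∈ Core R ] (1 ≤ length (R′ c) × (length (R′ c) ≤ m ⊎ length (R′ c) < length R))
    reduce {f} P f∈ with any? (dominatedOff? P f∈) R
    ... | no none = cycle-core P f∈ (λ {x} x∈ x∉C → decidable-stable (uniformOn? P f∈ x) (λ ¬u → none (lose x∈ (x∉C , ¬u))))
                  , s≤s z≤n , inj₁ (≤-reflexive (length-applyUpTo f m))
    ... | yes some with find some
    ...   | d , d∈ , d∉C , ¬u with trichotomy acyclic P f∈ d∈ (off P f∈ d∉C)
    ...     | inj₁ mono       = contradiction (uniformOn⁺ P f∈ mono) ¬u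
    ...     | inj₂ (inj₁ fol) = let c , p , q = dominated-core P f∈ d∈ d∉C fol in c , p , inj₂ q
    -- A vertex following the reversed cycle is treated like `fol`, with `backwards` in place of
    -- `f`.
    ...     | inj₂ (inj₂ rev) =
      let c , p , q = dominated-core (backwards-periodic P) (λ i → f∈ ((2 + l) * i)) d∈
                        (λ d∈C → let i , _ , e = ∈-applyUpTo⁻ (backwards (2 + l) f) d∈C in off P f∈ d∉C _ e) rev
      in c , p , inj₂ q

  -- Peeling single vertices when there is no rainbow triangle.

  -- The witnesses r₁ and r₂ make apex the centre of the star coloured hue.
  record Source (R : List V) : Set where
    field
      apex r₁ r₂ : V
      apex∈ : apex ∈ R
      r₁∈   : r₁ ∈ R
      r₂∈   : r₂ ∈ R
      r₁≢r₂ : r₁ ≢ r₂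
      apex≢r₁ : apex ≢ r₁
      apex≢r₂ : apex ≢ r₂
      hue   : X
      sends : ∀ {r} → r ∈ R → apex ≢ r → col apex r ≡ hue

  triangle : ∀ {R} → Acyclic R 3 → ∀ {a b c} → a ∈ R → b ∈ R → c ∈ R → a ≢ b → a ≢ c → b ≢ c →
             col a b ≡ col a c ⊎ col b a ≡ col b c ⊎ col c a ≡ col c b
  triangle acyclic {a} {b} {c} a∈ b∈ c∈ a≢b a≢c b≢c
    with col a b ≟ˣ col a c | col b a ≟ˣ col b c | col c a ≟ˣ col c b
  ... | yes p | _     | _     = inj₁ p
  ... | _     | yes q | _     = inj₂ (inj₁ q)
  ... | _     | _     | yes r = inj₂ (inj₂ r)
  ... | no ¬p | no ¬q | no ¬r = ⊥-elim (acyclic (a ∷ b ∷ c ∷ []) (cycleIn refl (a∈ ∷ b∈ ∷ c∈ ∷ [])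
    ( (a≢b ∷ a≢c ∷ []) ∷ (b≢c ∷ []) ∷ [] ∷ []
    , (λ e → ¬q (trans (col-sym b a) e))
    , (λ e → ¬r (trans (sym e) (col-sym b c)))
    , (λ e → ¬p (trans (sym e) (col-sym c a)))
    , tt)))

  -- Vertices are added one by one. If the apex does not send `hue` to the new vertex `x`, then `x`
  -- becomes the apex: in a triangle on `x`, `apex` and `r`, the colour `hue` is centred at `apex`,
  -- so the two equal edges can only meet at `x`.
  source : ∀ {R} → Acyclic R 3 → Unique R → 3 ≤ length R → Source R
  source {R = _ ∷ []} _ _ (s≤s ())
  source {R = _ ∷ _ ∷ []} _ _ (s≤s (s≤s ()))
  source {R = a ∷ b ∷ c ∷ []} acyclic ((a≢b ∷ a≢c ∷ []) ∷ (b≢c ∷ []) ∷ _) _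
    with triangle acyclic (here refl) (there (here refl)) (there (there (here refl))) a≢b a≢c b≢c
  ... | inj₁ e = record
    { apex = a ; r₁ = b ; r₂ = c ; apex∈ = here refl ; r₁∈ = there (here refl) ; r₂∈ = there (there (here refl))
    ; r₁≢r₂ = b≢c ; apex≢r₁ = a≢b ; apex≢r₂ = a≢c ; hue = col a b
    ; sends = λ { (here refl) n → contradiction refl n ; (there (here refl)) _ → refl ; (there (there (here refl))) _ → sym e } }
  ... | inj₂ (inj₁ e) = record
    { apex = b ; r₁ = a ; r₂ = c ; apex∈ = there (here refl) ; r₁∈ = here refl ; r₂∈ = there (there (here refl))
    ; r₁≢r₂ = a≢c ; apex≢r₁ = ≢-sym a≢b ; apex≢r₂ = b≢c ; hue = col b a
    ; sends = λ { (there (here refl)) n → contradiction refl n ; (here refl) _ → refl ; (there (there (here refl))) _ → sym e } }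
  ... | inj₂ (inj₂ e) = record
    { apex = c ; r₁ = a ; r₂ = b ; apex∈ = there (there (here refl)) ; r₁∈ = here refl ; r₂∈ = there (here refl)
    ; r₁≢r₂ = a≢b ; apex≢r₁ = ≢-sym a≢c ; apex≢r₂ = ≢-sym b≢c ; hue = col c a
    ; sends = λ { (there (there (here refl))) n → contradiction refl n ; (here refl) _ → refl ; (there (here refl)) _ → sym e } }
  source {R = x ∷ W@(_ ∷ _ ∷ _ ∷ _)} acyclic (x∉W ∷ uniq) _ = extend
    where
    S = source {R = W} (λ L c → acyclic L (cycleIn (CycleIn.length≡ c) (All.map there (CycleIn.within c)) (CycleIn.isCycle c)))
          uniq (s≤s (s≤s (s≤s z≤n)))
    open Source S
    x≢ : ∀ {v} → v ∈ W → x ≢ v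
    x≢ = All.lookup x∉W
    extend : Source (x ∷ W)
    extend with col apex x ≟ˣ hue
    ... | yes e = record
      { apex = apex ; r₁ = r₁ ; r₂ = r₂ ; apex∈ = there apex∈ ; r₁∈ = there r₁∈ ; r₂∈ = there r₂∈
      ; r₁≢r₂ = r₁≢r₂ ; apex≢r₁ = apex≢r₁ ; apex≢r₂ = apex≢r₂ ; hue = hue
      ; sends = λ { (here refl) _ → e ; (there r∈) n → sends r∈ n } }
    ... | no ¬e = record
      { apex = x ; r₁ = apex ; r₂ = r₁ ; apex∈ = here refl ; r₁∈ = there apex∈ ; r₂∈ = there r₁∈
      ; r₁≢r₂ = apex≢r₁ ; apex≢r₁ = x≢ apex∈ ; apex≢r₂ = x≢ r₁∈ ; hue = col x apex
      ; sends = λ { (here refl) n → contradiction refl n ; (there r∈) _ → to r∈ } }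
      where
      -- A second edge of colour `hue` at `apex`, other than the one to `r`, pins the centre for
      -- `fork`.
      another : ∀ r → ∃[ r′ ] (r′ ∈ W × apex ≢ r′ × r ≢ r′)
      another r with r ≟ r₁
      ... | yes refl = r₂ , r₂∈ , apex≢r₂ , r₁≢r₂
      ... | no  r≢r₁ = r₁ , r₁∈ , apex≢r₁ , r≢r₁
      to : ∀ {r} → r ∈ W → col x r ≡ col x apex
      to {r} r∈ with apex ≟ r
      ... | yes refl = refl
      ... | no apex≢r with triangle acyclic (here refl) (there apex∈) (there r∈) (x≢ apex∈) (x≢ r∈) apex≢r
      ...   | inj₁ e        = sym e
      ...   | inj₂ (inj₁ e) = contradiction (trans e (sends r∈ apex≢r)) ¬e
      ...   | inj₂ (inj₂ e) = let r′ , r′∈ , apex≢r′ , r≢r′ = another r in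
        ⊥-elim (fork apex≢r apex≢r′ r≢r′ (trans (sends r∈ apex≢r) (sym (sends r′∈ apex≢r′)))
          (≢-sym (x≢ r∈)) apex≢r (≢-sym (x≢ apex∈)) (trans e (col-sym r apex)))

  two-members : ∀ {R : List V} {a b} → a ∈ R → b ∈ R → a ≢ b → 2 ≤ length R
  two-members {_ ∷ _ ∷ _} _ _ _ = s≤s (s≤s z≤n)
  two-members {_ ∷ []} (here refl) (here refl) a≢b = contradiction refl a≢b

  source-core : ∀ {R} → Unique R → Source R → Σ[ c ∈ Core R ] (2 ≤ length (R′ c) × length (R′ c) < length R)
  source-core {R} uniq S = record
      { R′ = filter ≢apex? R ; R′⊆R = proj₁ ∘ ∈-filter⁻ ≢apex? ; unique = Uniqueₚ.filter⁺ ≢apex? uniq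
      ; peel = record
        { φ = λ _ → hue
        ; out = λ p q r → let r∈ , apex≢r = ∈-filter⁻ ≢apex? r in
            subst (λ v → col v _ ≡ hue) (is-apex p q) (sends r∈ apex≢r)
        ; between = λ p q r s a≢b → contradiction (trans (sym (is-apex p q)) (is-apex r s)) a≢b } }
    , two-members (∈-filter⁺ ≢apex? r₁∈ apex≢r₁) (∈-filter⁺ ≢apex? r₂∈ apex≢r₂) r₁≢r₂
    , filter-notAll ≢apex? R (lose apex∈ λ n → n refl)
    where
    open Source S
    ≢apex? : ∀ v → Dec (apex ≢ v)
    ≢apex? v = ¬? (apex ≟ v)
    is-apex : ∀ {a} → a ∈ R → a ∉ filter ≢apex? R → apex ≡ a
    is-apex {a} a∈ a∉ = decidable-stable (apex ≟ a) λ n → a∉ (∈-filter⁺ ≢apex? a∈ n)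

  -- Iterating down to a small core.

  acyclic-⊆ : ∀ {R S m} → (∀ {v} → v ∈ S → v ∈ R) → Acyclic R m → Acyclic S m
  acyclic-⊆ S⊆R acyclic L (cycleIn len ins cyc) = acyclic L (cycleIn len (All.map S⊆R ins) cyc)

  -- A source exists as long as three vertices remain, and peeling it leaves at least two, so the
  -- process stops at exactly two. The bound `b` on the size makes the recursion structural.
  core₃ : ∀ b {R} → length R ≤ b → Acyclic R 3 → Unique R → 2 ≤ length R →
          Σ[ c ∈ Core R ] length (R′ c) ≡ 2
  core₃ b {R} ≤b acyclic uniq 2≤ with m≤n⇒m<n∨m≡n 2≤
  ... | inj₂ 2≡ = core-refl uniq , sym 2≡
  core₃ zero    ≤b _ _ _ | inj₁ 3≤ = contradiction (≤-trans 3≤ ≤b) λ ()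
  core₃ (suc b) ≤b acyclic uniq 2≤ | inj₁ 3≤ =
    let c , 2≤c , c< = source-core uniq (source acyclic uniq 3≤)
        d , d≡2 = core₃ b (s≤s⁻¹ (<-≤-trans c< ≤b)) (acyclic-⊆ (R′⊆R c) acyclic) (unique c) 2≤c
    in core-trans c d , d≡2

  -- If a cycle of length `3 + l` exists, `reduce` either finishes or shrinks the set and with it
  -- `b`. If none exists, that shorter length is forbidden too and `l` drops, ending at `core₃`.
  core₄₊ : ∀ l b {R} → length R ≤ b → Acyclic R (4 + l) → Unique R → 1 ≤ length R →
           Σ[ c ∈ Core R ] (1 ≤ length (R′ c) × length (R′ c) ≤ 3 + l)
  core₄₊ l b {R} ≤b acyclic uniq 1≤ with length R ≤? 3 + l
  ... | yes small = core-refl uniq , 1≤ , small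
  core₄₊ l zero    ≤b _ _ 1≤ | no _ = contradiction (≤-trans 1≤ ≤b) λ ()
  core₄₊ l (suc b) {R} ≤b acyclic uniq 1≤ | no large with cycle⊎acyclic R (3 + l)
  ... | inj₁ (L , cyc) = descend (let f , P , f∈ = unroll cyc in reduce acyclic uniq P f∈)
    where
    descend : Σ[ c ∈ Core R ] (1 ≤ length (R′ c) × (length (R′ c) ≤ 3 + l ⊎ length (R′ c) < length R)) →
              Σ[ c ∈ Core R ] (1 ≤ length (R′ c) × length (R′ c) ≤ 3 + l)
    descend (c , 1≤c , inj₁ small) = c , 1≤c , small
    descend (c , 1≤c , inj₂ c<) =
      let d , 1≤d , small = core₄₊ l b (s≤s⁻¹ (<-≤-trans c< ≤b)) (acyclic-⊆ (R′⊆R c) acyclic) (unique c) 1≤c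
      in core-trans c d , 1≤d , small
  core₄₊ zero    (suc b) {R} _  _ uniq _  | no large | inj₂ acyclic =
    let c , c≡2 = core₃ _ ≤-refl acyclic uniq (<⇒≤ (<-trans (n<1+n 2) (≰⇒> large)))
    in c , subst (1 ≤_) (sym c≡2) (s≤s z≤n) , subst (_≤ 3) (sym c≡2) (n≤1+n 2)
  core₄₊ (suc l) (suc b) {R} ≤b _ uniq 1≤ | no large | inj₂ acyclic =
    let c , 1≤c , small = core₄₊ l (suc b) ≤b acyclic uniq 1≤
    in c , 1≤c , ≤-trans small (n≤1+n _)

-- Successors modulo k, and a pigeonhole count.

↝-functional : ∀ {k} {i j j′ : Fin k} → i ↝ j → i ↝ j′ → j ≡ j′
↝-functional (step p)   (step q)    = Finₚ.toℕ-injective (trans p (sym q))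
↝-functional {j = j} (step p) (wrap q _)   = contradiction (trans p q) (<⇒≢ (Finₚ.toℕ<n j))
↝-functional {j′ = j} (wrap q _) (step p)  = contradiction (trans p q) (<⇒≢ (Finₚ.toℕ<n j))
↝-functional (wrap _ p) (wrap _ q)  = Finₚ.toℕ-injective (trans p (sym q))

↝-injective : ∀ {k} {i i′ j : Fin k} → i ↝ j → i′ ↝ j → i ≡ i′
↝-injective (step p)   (step q)   = Finₚ.toℕ-injective (suc-injective (trans (sym p) q))
↝-injective (step p)   (wrap _ q) = contradiction (trans (sym p) q) λ ()
↝-injective (wrap _ q) (step p)   = contradiction (trans (sym p) q) λ ()
↝-injective (wrap p _) (wrap q _) = Finₚ.toℕ-injective (suc-injective (trans p (sym q)))

missed⇒< : ∀ {s N} {h : Fin s → Fin N} → Injective _≡_ _≡_ h → ∀ r → (∀ i → r ≢ h i) → s < N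
missed⇒< {N = suc _} inj r missed =
  s≤s (Finₚ.injective⇒≤ {f = λ i → punchOut (missed i)} λ e → inj (Finₚ.punchOut-injective (missed _) (missed _) e))

module Slots {A B : Set} {s} (ι : Fin s → B) (ι-injective : Injective _≡_ _≡_ ι)
  (S : List A) (g : A → B) (onto : ∀ i → ∃[ σ ] (σ ∈ S × g σ ≡ ι i)) where

  private
    position : Fin s → Fin (length S)
    position i = index (proj₁ (proj₂ (onto i)))

    g-position : ∀ i → g (lookup S (position i)) ≡ ι i
    g-position i = let _ , σ∈ , e = onto i in trans (cong g (sym (lookup-index σ∈))) e

    position-injective : Injective _≡_ _≡_ position
    position-injective {i} {j} e =
      ι-injective (trans (sym (g-position i)) (trans (cong (g ∘ lookup S) e) (g-position j)))

  enough : s ≤ length S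
  enough = Finₚ.injective⇒≤ position-injective

  -- Each colour picks one position in `S`. Of two positions with the same colour at most one is
  -- picked, so the number of colours would be strictly below the length.
  tight⇒injective : length S ≤ s → ∀ {σ τ} → σ ∈ S → τ ∈ S → g σ ≡ g τ → σ ≡ τ
  tight⇒injective tight {σ} {τ} σ∈ τ∈ gσ≡gτ with index σ∈ Finₚ.≟ index τ∈
  ... | yes p≡q = trans (lookup-index σ∈) (trans (cong (lookup S) p≡q) (sym (lookup-index τ∈)))
  ... | no  p≢q with Finₚ.any? (λ i → index σ∈ Finₚ.≟ position i)
  ...   | no  missed   = contradiction tight (<⇒≱ (missed⇒< position-injective (index σ∈) λ i e → missed (i , e)))
  ...   | yes (i , p≡) = contradiction tight (<⇒≱ (missed⇒< position-injective (index τ∈) missed))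
    where
    missed : ∀ j → index τ∈ ≢ position j
    missed j q≡ = p≢q (trans p≡ (trans (cong position (ι-injective (begin
        ι i                        ≡⟨ g-position i ⟨
        g (lookup S (position i))  ≡⟨ cong (g ∘ lookup S) p≡ ⟨
        g (lookup S (index σ∈))    ≡⟨ cong g (lookup-index σ∈) ⟨
        g σ                        ≡⟨ gσ≡gτ ⟩
        g τ                        ≡⟨ cong g (lookup-index τ∈) ⟩
        g (lookup S (index τ∈))    ≡⟨ cong (g ∘ lookup S) q≡ ⟩
        g (lookup S (position j))  ≡⟨ g-position j ⟩
        ι j                        ∎))) (sym q≡)))
      where open ≡-Reasoning

-- Unordered pairs from a list, and lists as vertex subsets.

pairs : {A : Set} → List A → List (A × A)
pairs []       = []
pairs (x ∷ xs) = map (x ,_) xs ++ pairs xs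

[1+n]C2 : ∀ n → suc n C 2 ≡ n + n C 2
[1+n]C2 n = trans (sym (nCk+nC[k+1]≡[n+1]C[k+1] n 1)) (cong (_+ n C 2) (nC1≡n n))

length-pairs : ∀ {A : Set} (xs : List A) → length (pairs xs) ≡ length xs C 2
length-pairs []       = refl
length-pairs (x ∷ xs) = begin
  length (map (x ,_) xs ++ pairs xs)           ≡⟨ length-++ (map (x ,_) xs) ⟩
  length (map (x ,_) xs) + length (pairs xs)   ≡⟨ cong₂ _+_ (length-map (x ,_) xs) (length-pairs xs) ⟩
  length xs + length xs C 2                    ≡⟨ [1+n]C2 (length xs) ⟨
  suc (length xs) C 2                          ∎
  where open ≡-Reasoning

∈-pairs : ∀ {A : Set} {xs : List A} {x y} → x ∈ xs → y ∈ xs → x ≢ y →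
          (x , y) ∈ pairs xs ⊎ (y , x) ∈ pairs xs
∈-pairs (here refl) (here refl) x≢y = contradiction refl x≢y
∈-pairs (here refl) (there y∈)  _   = inj₁ (∈-++⁺ˡ (∈-map⁺ _ y∈))
∈-pairs (there x∈)  (here refl) _   = inj₂ (∈-++⁺ˡ (∈-map⁺ _ x∈))
∈-pairs {xs = z ∷ zs} (there x∈) (there y∈) x≢y with ∈-pairs x∈ y∈ x≢y
... | inj₁ p = inj₁ (∈-++⁺ʳ (map (z ,_) zs) p)
... | inj₂ p = inj₂ (∈-++⁺ʳ (map (z ,_) zs) p)

fromList : ∀ {n} → List (Fin n) → Subset n
fromList []       = ∅
fromList (x ∷ xs) = fromList xs [ x ]≔ inside

∈-fromList⁺ : ∀ {n} {xs : List (Fin n)} {x} → x ∈ xs → x ∈ˢ fromList xs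
∈-fromList⁺ {xs = y ∷ ys} (here refl) = []≔-updates (fromList ys) y
∈-fromList⁺ {xs = y ∷ ys} {x} (there x∈) with x Finₚ.≟ y
... | yes refl = []≔-updates (fromList ys) y
... | no  x≢y  = []≔-minimal (fromList ys) x y x≢y (∈-fromList⁺ x∈)

∈-insert⁻ : ∀ {n} (p : Subset n) x {y} → y ∈ˢ p [ x ]≔ inside → y ≡ x ⊎ y ∈ˢ p
∈-insert⁻ (_ ∷ p) zero    here        = inj₁ refl
∈-insert⁻ (_ ∷ p) zero    (there y∈)  = inj₂ (there y∈)
∈-insert⁻ (_ ∷ p) (suc x) here        = inj₂ here
∈-insert⁻ (_ ∷ p) (suc x) (there y∈)  with ∈-insert⁻ p x y∈
... | inj₁ refl = inj₁ refl
... | inj₂ y∈p  = inj₂ (there y∈p)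

∈-fromList⁻ : ∀ {n} (xs : List (Fin n)) {x} → x ∈ˢ fromList xs → x ∈ xs
∈-fromList⁻ []       x∈ = contradiction x∈ Subsetₚ.∉⊥
∈-fromList⁻ (y ∷ ys) x∈ with ∈-insert⁻ (fromList ys) y x∈
... | inj₁ refl = here refl
... | inj₂ x∈ys = there (∈-fromList⁻ ys x∈ys)

∣insert∣ : ∀ {n} (p : Subset n) x → x ∉ˢ p → ∣ p [ x ]≔ inside ∣ ≡ suc ∣ p ∣
∣insert∣ (inside  ∷ p) zero    x∉ = contradiction here x∉
∣insert∣ (outside ∷ p) zero    x∉ = refl
∣insert∣ (inside  ∷ p) (suc x) x∉ = cong suc (∣insert∣ p x (x∉ ∘ there))
∣insert∣ (outside ∷ p) (suc x) x∉ = ∣insert∣ p x (x∉ ∘ there)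

∣fromList∣ : ∀ {n} {xs : List (Fin n)} → Unique xs → ∣ fromList xs ∣ ≡ length xs
∣fromList∣ {n} []                    = Subsetₚ.∣⊥∣≡0 n
∣fromList∣ {xs = x ∷ xs} (x∉ ∷ uniq) =
  trans (∣insert∣ (fromList xs) x λ x∈ → All.lookup x∉ (∈-fromList⁻ xs x∈) refl) (cong suc (∣fromList∣ uniq))

-- Passing from a `Colouring` to the colour function `col`.

module Edges {n t} (c : Colouring (K n) (Fin t)) (star : IsStarColouring c) where

  -- The junk value nothing on the diagonal dispenses with proofs of x ≢ y.
  col : Fin n → Fin n → Maybe (Fin t)
  col x y with x Finₚ.≟ y
  ... | yes _  = nothing
  ... | no x≢y = just (colour c x y x≢y)

  col-edge : ∀ {x y} (x≢y : x ≢ y) → col x y ≡ just (colour c x y x≢y)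
  col-edge {x} {y} x≢y with x Finₚ.≟ y
  ... | yes x≡y = contradiction x≡y x≢y
  ... | no _    = refl

  col-sym : ∀ x y → col x y ≡ col y x
  col-sym x y with x Finₚ.≟ y | y Finₚ.≟ x
  ... | yes _   | yes _   = refl
  ... | yes x≡y | no y≢x  = contradiction (sym x≡y) y≢x
  ... | no x≢y  | yes y≡x = contradiction (sym y≡x) x≢y
  ... | no x≢y  | no y≢x  = cong just (colour-sym c x y x≢y y≢x)

  centre : ∀ {x y} → x ≢ y → ∃[ z ] (∀ {u v} → u ≢ v → col u v ≡ col x y → z ≡ u ⊎ z ≡ v)
  centre {x} {y} x≢y = Copy.map copy zero , λ u≢v e →
    ends (covers (u≢v , just-injective (trans (sym (col-edge u≢v)) (trans e (col-edge x≢y)))))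
    where
    open IsStar (star (colour c x y x≢y) (x , y , x≢y , refl))
    ends : ∀ {u v} → ∃[ i ] ∃[ j ] (StarAdj i j × Copy.map copy i ≡ u × Copy.map copy j ≡ v) →
           Copy.map copy zero ≡ u ⊎ Copy.map copy zero ≡ v
    ends (_ , _ , outward , e , _) = inj₁ e
    ends (_ , _ , inward  , _ , e) = inj₂ e

  open StarColoured Finₚ._≟_ (≡-dec Finₚ._≟_) col col-sym centre public

  module _ {k} (3≤k : 3 ≤ k) where

    -- Two arcs of one colour both contain the centre `z`. If `z` is the tail of both or the head of
    -- both, the arcs coincide; otherwise one follows the other, and consecutive arcs differ in
    -- colour.
    proper⇒rainbow : (h : Fin k → Fin n) → Injective _≡_ _≡_ h →
                     (∀ {i j l} → i ↝ j → j ↝ l → col (h i) (h j) ≢ col (h j) (h l)) →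
                     RainbowCopy (Cycle k 3≤k) c
    proper⇒rainbow h h-inj proper = record
      { copy = record { map = h ; injective = h-inj ; preserves = λ e e′ → adjacent≢ e (h-inj e′) }
      ; rainbow = rainbow
      }
      where
      adjacent≢ : ∀ {i j} → Adj (Cycle k 3≤k) i j → i ≢ j
      adjacent≢ e refl = irrefl (Cycle k 3≤k) e

      arcs : ∀ {i j i′ j′} → i ↝ j → i′ ↝ j′ → col (h i) (h j) ≡ col (h i′) (h j′) → i ≡ i′ × j ≡ j′
      arcs {i} {j} {i′} {j′} a a′ e = meet (covers (ne a) refl) (covers (ne a′) (sym e))
        where
        ne : ∀ {i j} → i ↝ j → h i ≢ h j
        ne a = adjacent≢ (inj₁ a) ∘ h-inj
        z = proj₁ (centre (ne a))
        covers = proj₂ (centre (ne a))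
        meet : z ≡ h i ⊎ z ≡ h j → z ≡ h i′ ⊎ z ≡ h j′ → i ≡ i′ × j ≡ j′
        meet (inj₁ p) (inj₁ q) with refl ← h-inj (trans (sym p) q) = refl , ↝-functional a a′
        meet (inj₁ p) (inj₂ q) with refl ← h-inj (trans (sym p) q) = contradiction (sym e) (proper a′ a)
        meet (inj₂ p) (inj₁ q) with refl ← h-inj (trans (sym p) q) = contradiction e (proper a a′)
        meet (inj₂ p) (inj₂ q) with refl ← h-inj (trans (sym p) q) = ↝-injective a a′ , refl

      rainbow : ∀ {i j i′ j′} (e : Adj (Cycle k 3≤k) i j) (e′ : Adj (Cycle k 3≤k) i′ j′) →
                colour c (h i) (h j) (adjacent≢ e ∘ h-inj) ≡ colour c (h i′) (h j′) (adjacent≢ e′ ∘ h-inj) →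
                SameEdge i j i′ j′
      rainbow {i} {j} {i′} {j′} e e′ same =
        by e e′ (trans (col-edge (adjacent≢ e ∘ h-inj)) (trans (cong just same) (sym (col-edge (adjacent≢ e′ ∘ h-inj)))))
        where
        by : Adj (Cycle k 3≤k) i j → Adj (Cycle k 3≤k) i′ j′ → col (h i) (h j) ≡ col (h i′) (h j′) → SameEdge i j i′ j′
        by (inj₁ a) (inj₁ b) eq = inj₁ (arcs a b eq)
        by (inj₁ a) (inj₂ b) eq = inj₂ (arcs a b (trans eq (col-sym _ _)))
        by (inj₂ a) (inj₁ b) eq = let p , q = arcs a b (trans (col-sym _ _) eq) in inj₂ (q , p)
        by (inj₂ a) (inj₂ b) eq = let p , q = arcs a b (trans (col-sym _ _) (trans eq (col-sym _ _))) in inj₁ (q , p)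

    acyclic : ¬ RainbowCopy (Cycle k 3≤k) c → ∀ R → Acyclic R k
    acyclic none R L cyc with f , P , _ ← unroll cyc =
      none (proper⇒rainbow (f ∘ toℕ)
        (λ {i} {j} e → Finₚ.toℕ-injective (Periodic.injective P (Finₚ.toℕ<n i) (Finₚ.toℕ<n j) e))
        (λ a b e → Periodic.proper P _ (subst₂ _≡_ (cong (col _) (next a))
          (cong₂ col (next a) (trans (next b) (next-suc a))) e)))
      where
      next : ∀ {i j : Fin k} → i ↝ j → f (toℕ j) ≡ f (suc (toℕ i))
      next (step e)   = cong f e
      next (wrap p q) = trans (cong f q) (trans (sym (closing P)) (cong f (sym p)))
      next-suc : ∀ {i j : Fin k} → i ↝ j → f (suc (toℕ j)) ≡ f (suc (suc (toℕ i)))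
      next-suc (step e)   = cong (f ∘ suc) e
      next-suc (wrap p q) = trans (cong (f ∘ suc) q)
        (trans (sym (Periodic.period P 1)) (cong f (trans (+-comm k 1) (cong suc (sym p)))))

  -- For `k` equal to 3, cores of one and of two vertices give the same bound on the colours, so the
  -- exact size is recorded; from 4 on, equality in the count forces it.
  core : ∀ {k} → 3 ≤ k → k ≤ n → Acyclic (allFin n) k →
         Σ[ c ∈ Core (allFin n) ] (let r = length (Core.R′ c) in 1 ≤ r × r ≤ k ∸ 1 × (r ≡ k ∸ 1 ⊎ 4 ≤ k))
  core {3} _ k≤n acyclic =
    let c , r≡2 = core₃ n (≤-reflexive len) acyclic (Uniqueₚ.allFin⁺ n) (subst (2 ≤_) (sym len) (<⇒≤ k≤n))
    in c , subst (1 ≤_) (sym r≡2) (s≤s z≤n) , ≤-reflexive r≡2 , inj₁ r≡2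
    where len = length-tabulate {n = n} id
  core {suc (suc (suc (suc l)))} _ k≤n acyclic =
    let c , 1≤r , r≤ = core₄₊ l n (≤-reflexive len) acyclic (Uniqueₚ.allFin⁺ n) (subst (1 ≤_) (sym len) (≤-trans (s≤s z≤n) k≤n))
    in c , 1≤r , r≤ , inj₂ (s≤s (s≤s (s≤s (s≤s z≤n))))
    where len = length-tabulate {n = n} id
  core {1} (s≤s ())
  core {2} (s≤s (s≤s ()))

pred-complement : ∀ {n k} → 3 ≤ k → k ≤ n → n ∸ (k ∸ 1) ≡ n ∸ k + 1
pred-complement (s≤s {n = k} _) (s≤s {n = n} k≤n) = trans (+-∸-assoc 1 k≤n) (+-comm 1 (n ∸ k))

-- Counting colours over a core, and the case of equality.

module Decomposed {n t} (c : Colouring (K n) (Fin t)) (star : IsStarColouring c) (used : ∀ i → IsUsed c i)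
  (core : Edges.Core c star (allFin n)) where

  open Edges c star hiding (core)
  open Core core renaming (R′ to R; unique to R-unique)
  open Peel peel
  open import Data.List.Membership.DecPropositional (Finₚ._≟_ {n}) using (_∈?_)

  private
    ∉R? : ∀ x → Dec (x ∉ R)
    ∉R? x = ¬? (x ∈? R)

  peeled : List (Fin n)
  peeled = filter ∉R? (allFin n)

  ∈-peeled : ∀ {x} → x ∉ R → x ∈ peeled
  ∈-peeled x∉R = ∈-filter⁺ ∉R? (∈-allFin _) x∉R

  length-peeled : length peeled + length R ≡ n
  length-peeled = trans (sym (length-++ peeled)) (trans (↭-length (∼bag⇒↭ (unique∧set⇒bag
      (Uniqueₚ.++⁺ (Uniqueₚ.filter⁺ ∉R? (Uniqueₚ.allFin⁺ n)) R-unique λ (p , q) → proj₂ (∈-filter⁻ ∉R? {xs = allFin n} p) q)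
      (Uniqueₚ.allFin⁺ n) (mk⇔ (λ _ → ∈-allFin _) (λ _ → everywhere _))))) (length-tabulate {n = n} id))
    where
    everywhere : ∀ x → x ∈ peeled ++ R
    everywhere x with x ∈? R
    ... | yes x∈R = ∈-++⁺ʳ peeled x∈R
    ... | no  x∉R = ∈-++⁺ˡ (∈-peeled x∉R)

  Slot : Set
  Slot = Fin n ⊎ Fin n × Fin n

  slots : List Slot
  slots = map inj₁ peeled ++ map inj₂ (pairs R)

  length-slots : length slots ≡ length peeled + length R C 2
  length-slots = trans (length-++ (map inj₁ peeled))
    (cong₂ _+_ (length-map inj₁ peeled) (trans (length-map inj₂ (pairs R)) (length-pairs R)))

  hue : Slot → Maybe (Fin t)
  hue (inj₁ a)       = φ a
  hue (inj₂ (u , v)) = col u v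

  vertex-slot : ∀ {x} → x ∉ R → inj₁ x ∈ slots
  vertex-slot x∉R = ∈-++⁺ˡ (∈-map⁺ inj₁ (∈-peeled x∉R))

  -- `pairs` lists each core pair in one order only, hence both `forth` and `back`.
  data SlotOf (x y : Fin n) (σ : Slot) : Set where
    forth  : σ ≡ inj₂ (x , y) → SlotOf x y σ
    back   : σ ≡ inj₂ (y , x) → SlotOf x y σ
    vertex : ∀ {a} → σ ≡ inj₁ a → ¬ (x ∈ R × y ∈ R) → SlotOf x y σ

  slotOf : ∀ {x y} → x ≢ y → ∃[ σ ] (σ ∈ slots × hue σ ≡ col x y × SlotOf x y σ)
  slotOf {x} {y} x≢y with x ∈? R | y ∈? R
  ... | yes x∈ | yes y∈ with ∈-pairs x∈ y∈ x≢y
  ...   | inj₁ p = _ , ∈-++⁺ʳ (map inj₁ peeled) (∈-map⁺ inj₂ p) , refl , forth refl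
  ...   | inj₂ p = _ , ∈-++⁺ʳ (map inj₁ peeled) (∈-map⁺ inj₂ p) , col-sym y x , back refl
  slotOf {x} {y} x≢y | no x∉ | yes y∈ =
    _ , vertex-slot x∉ , sym (out (∈-allFin x) x∉ y∈) , vertex refl (x∉ ∘ proj₁)
  slotOf {x} {y} x≢y | yes x∈ | no y∉ =
    _ , vertex-slot y∉ , trans (sym (out (∈-allFin y) y∉ x∈)) (col-sym y x) , vertex refl (y∉ ∘ proj₂)
  slotOf {x} {y} x≢y | no x∉ | no y∉ with between (∈-allFin x) x∉ (∈-allFin y) y∉ x≢y
  ... | inj₁ e = _ , vertex-slot x∉ , sym e , vertex refl (x∉ ∘ proj₁)
  ... | inj₂ e = _ , vertex-slot y∉ , sym e , vertex refl (y∉ ∘ proj₂)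

  onto : ∀ i → ∃[ σ ] (σ ∈ slots × hue σ ≡ just i)
  onto i = let x , y , x≢y , e = used i
               σ , σ∈ , h , _ = slotOf x≢y
           in σ , σ∈ , trans h (trans (col-edge x≢y) (cong just e))

  open Slots just just-injective slots hue onto

  colours≤ : t ≤ length peeled + length R C 2
  colours≤ = subst (t ≤_) length-slots enough

  module Tight (tight : length peeled + length R C 2 ≤ t) where

    hue-injective : ∀ {σ τ} → σ ∈ slots → τ ∈ slots → hue σ ≡ hue τ → σ ≡ τ
    hue-injective = tight⇒injective (subst (_≤ t) (sym length-slots) tight)

    φ-injective : ∀ {x y} → x ∉ R → y ∉ R → φ x ≡ φ y → x ≡ y
    φ-injective x∉ y∉ e = inj₁-injective (hue-injective (vertex-slot x∉) (vertex-slot y∉) e)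

    owner? : ∀ i → (∃[ a ] (a ∉ R × φ a ≡ just i)) ⊎ (∀ a → a ∉ R → φ a ≢ just i)
    owner? i with any? (λ a → ≡-dec Finₚ._≟_ (φ a) (just i)) peeled
    ... | yes some = inj₁ (let a , a∈ , e = find some in a , proj₂ (∈-filter⁻ ∉R? {xs = allFin n} a∈) , e)
    ... | no none  = inj₂ λ a a∉ e → none (lose (∈-peeled a∉) e)

    ρ : Fin t → Palette n
    ρ i = [ inj₁ ∘ proj₁ , const (inj₂ (toℕ i)) ]′ (owner? i)

    ρ-owned : ∀ {a i} → a ∉ R → φ a ≡ just i → ρ i ≡ inj₁ a
    ρ-owned {a} {i} a∉ e with owner? i
    ... | inj₁ (b , b∉ , e′) = cong inj₁ (φ-injective b∉ a∉ (trans e′ (sym e)))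
    ... | inj₂ none          = contradiction e (none a a∉)

    ρ-injective : Injective _≡_ _≡_ ρ
    ρ-injective {i} {j} eq with owner? i | owner? j
    ... | inj₁ (a , _ , e) | inj₁ (b , _ , e′) =
      just-injective (trans (sym e) (trans (cong φ (inj₁-injective eq)) e′))
    ... | inj₂ _ | inj₂ _ = Finₚ.toℕ-injective (inj₂-injective eq)
    ... | inj₁ _ | inj₂ _ = contradiction eq λ ()
    ... | inj₂ _ | inj₁ _ = contradiction eq λ ()

    module _ {k} (3≤k : 3 ≤ k) (k≤n : k ≤ n) (none : ¬ RainbowCopy (Cycle k 3≤k) c) (size : length R ≡ k ∸ 1) where

      extremal : Extremal k 3≤k (rename (Injection.to (mk↣ ρ-injective)) c)
      extremal = record
        { A         = ∁ B
        ; B         = B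
        ; cover     = trans (Subsetₚ.∪-comm (∁ B) B) (Subsetₚ.p∪∁p≡⊤ B)
        ; disjoint  = λ (x , x∈) → let x∈A , x∈B = Subsetₚ.x∈p∩q⁻ (∁ B) B x∈ in Subsetₚ.x∈∁p⇒x∉p x∈A x∈B
        ; ∣A∣       = trans (Subsetₚ.∣∁p∣≡n∸∣p∣ B) (trans (cong (n ∸_) ∣B∣) (pred-complement 3≤k k≤n))
        ; ∣B∣       = ∣B∣
        ; τ         = τ
        ; τ-tour    = record
          { within = λ (x∉ , y∉ , _) → ∉R⇒∈A x∉ , ∉R⇒∈A y∉
          ; total  = λ x∈ y∈ x≢y → total (∈A⇒∉R x∈) (∈A⇒∉R y∈) x≢y }
        ; τ-noCycle = no-directed
        ; T         = record { Arc = Arcs ; asym = arcs-asym }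
        ; T-arcs    = λ _ _ → mk⇔ id id
        ; A-colours = λ x∈ arc x≢y → ρ-owned (∈A⇒∉R x∈) (trans (sym (A-col x∈ arc)) (col-edge x≢y))
        ; B-colours = B-colours
        }
        where
        B : Subset n
        B = fromList R
        ∣B∣ : ∣ B ∣ ≡ k ∸ 1
        ∣B∣ = trans (∣fromList∣ R-unique) size
        ∉R⇒∈A : ∀ {x} → x ∉ R → x ∈ˢ ∁ B
        ∉R⇒∈A x∉ = Subsetₚ.x∉p⇒x∈∁p (x∉ ∘ ∈-fromList⁻ R)
        ∈A⇒∉R : ∀ {x} → x ∈ˢ ∁ B → x ∉ R
        ∈A⇒∉R x∈ x∈R = Subsetₚ.x∈∁p⇒x∉p x∈ (∈-fromList⁺ x∈R)

        τ : OrientedGraph n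
        τ = record
          -- An edge between peeled vertices points away from the end whose colour it has;
          -- injectivity of `φ` makes this end unique.
          { Arc  = λ x y → x ∉ R × y ∉ R × x ≢ y × col x y ≡ φ x
          ; asym = λ (x∉ , y∉ , x≢y , e) (_ , _ , _ , e′) →
              x≢y (φ-injective x∉ y∉ (trans (sym e) (trans (col-sym _ _) e′)))
          }
        total : ∀ {x y} → x ∉ R → y ∉ R → x ≢ y → Arc τ x y ⊎ Arc τ y x
        total x∉ y∉ x≢y with between (∈-allFin _) x∉ (∈-allFin _) y∉ x≢y
        ... | inj₁ e = inj₁ (x∉ , y∉ , x≢y , e)
        ... | inj₂ e = inj₂ (y∉ , x∉ , ≢-sym x≢y , trans (col-sym _ _) e)

        -- Arcs of `τ` have the colours of their tails, and consecutive tails are distinct, so a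
        -- directed cycle would be rainbow.
        no-directed : ¬ DirectedCopy (DirectedCycle k 3≤k) τ
        no-directed D = none (proper⇒rainbow 3≤k (DirectedCopy.map D) injective λ a b e →
          let x∉ , y∉ , x≢y , ex = preserves a
              _  , _  , _   , ey = preserves b
          in x≢y (φ-injective x∉ y∉ (trans (sym ex) (trans e ey))))
          where open DirectedCopy D hiding (map)

        Arcs : Fin n → Fin n → Set
        Arcs x y = Arc τ x y ⊎ (x ∈ˢ ∁ B × y ∈ˢ B)
        arcs-asym : ∀ {x y} → Arcs x y → ¬ Arcs y x
        arcs-asym (inj₁ a)         (inj₁ b)         = asym τ a b
        arcs-asym (inj₁ (x∉ , _))  (inj₂ (_ , x∈))  = x∉ (∈-fromList⁻ R x∈)
        arcs-asym (inj₂ (_ , y∈))  (inj₁ (y∉ , _))  = y∉ (∈-fromList⁻ R y∈)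
        arcs-asym (inj₂ (x∈ , _))  (inj₂ (_ , x∈B)) = Subsetₚ.x∈∁p⇒x∉p x∈ x∈B

        A-col : ∀ {x y} → x ∈ˢ ∁ B → Arcs x y → col x y ≡ φ x
        A-col x∈ (inj₁ (_ , _ , _ , e)) = e
        A-col x∈ (inj₂ (_ , y∈))        = out (∈-allFin _) (∈A⇒∉R x∈) (∈-fromList⁻ R y∈)

        B-colours : ∀ {u v x y} → u ∈ˢ B → v ∈ˢ B → (u≢v : u ≢ v) (x≢y : x ≢ y) →
                    ρ (colour c u v u≢v) ≡ ρ (colour c x y x≢y) → SameEdge u v x y
        B-colours u∈ v∈ u≢v x≢y e with slotOf u≢v | slotOf x≢y
        ... | σ , σ∈ , hσ , s | τ , τ∈ , hτ , s′ = compare s s′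
          where
          -- Equal colours occupy the same slot, and the slot of a core pair determines that pair.
          σ≡τ : σ ≡ τ
          σ≡τ = hue-injective σ∈ τ∈ (trans hσ (trans (trans (col-edge u≢v)
            (trans (cong just (ρ-injective e)) (sym (col-edge x≢y)))) (sym hτ)))
          same : ∀ {p q} → σ ≡ inj₂ p → τ ≡ inj₂ q → p ≡ q
          same a b = inj₂-injective (trans (sym a) (trans σ≡τ b))
          compare : SlotOf _ _ σ → SlotOf _ _ τ → SameEdge _ _ _ _
          compare (vertex _ off) _ = contradiction (∈-fromList⁻ R u∈ , ∈-fromList⁻ R v∈) off
          compare (forth a) (vertex b _) = contradiction (trans (sym a) (trans σ≡τ b)) λ ()
          compare (back a)  (vertex b _) = contradiction (trans (sym a) (trans σ≡τ b)) λ ()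
          compare (forth a) (forth b) with refl ← same a b = inj₁ (refl , refl)
          compare (forth a) (back b)  with refl ← same a b = inj₂ (refl , refl)
          compare (back a)  (forth b) with refl ← same a b = inj₂ (refl , refl)
          compare (back a)  (back b)  with refl ← same a b = inj₁ (refl , refl)

-- Lower bound: colourings built one vertex at a time.

cone : ∀ {n s s′} → (Fin n → Fin s′) → (Fin s → Fin s′) → Colouring (K n) (Fin s) → Colouring (K (suc n)) (Fin s′)
cone {n} {s} {s′} α ι c = record { colour = col ; colour-sym = col-sym }
  where
  col : ∀ x y → .(x ≢ y) → Fin s′
  col zero    zero    p = ⊥-elim-irr (p refl)
  col zero    (suc y) _ = α y
  col (suc x) zero    _ = α x
  col (suc x) (suc y) p = ι (colour c x y λ e → p (cong suc e))
  col-sym : ∀ x y .(p : x ≢ y) .(q : y ≢ x) → col x y p ≡ col y x q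
  col-sym zero    zero    p _ = ⊥-elim-irr (p refl)
  col-sym zero    (suc y) _ _ = refl
  col-sym (suc x) zero    _ _ = refl
  col-sym (suc x) (suc y) p q = cong ι (colour-sym c x y (λ e → p (cong suc e)) (λ e → q (cong suc e)))

cone-star : ∀ {n s s′} {α : Fin n → Fin s′} {ι : Fin s → Fin s′} {c : Colouring (K n) (Fin s)} →
            Injective _≡_ _≡_ ι → ∀ {i} → (∀ j → α j ≢ ι i) →
            IsStar (colourClass c i) → IsStar (colourClass (cone α ι c) (ι i))
cone-star {ι = ι} ι-inj α≢ S = record
  { m = m ; 1≤m = 1≤m
  ; copy = record
    { map = suc ∘ Copy.map copy
    ; injective = Copy.injective copy ∘ Finₚ.suc-injective
    ; preserves = λ e → let p , eq = Copy.preserves copy e in (λ e′ → p (Finₚ.suc-injective e′)) , cong ι eq }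
  ; covers = λ { {zero}  {zero}  (p , _) → contradiction refl p
               ; {zero}  {suc y} (_ , e) → contradiction e (α≢ y)
               ; {suc x} {zero}  (_ , e) → contradiction e (α≢ x)
               ; {suc x} {suc y} (p , e) → let i , j , a , ei , ej = covers ((λ e′ → p (cong suc e′)) , ι-inj e)
                                           in i , j , a , cong suc ei , cong suc ej }
  }
  where open IsStar S

-- The recursion matches the colours added by each new vertex of `rainbowColouring`, so the types
-- agree by computation.
triangular : ℕ → ℕ
triangular zero    = 0
triangular (suc m) = m + triangular m

triangular≡C2 : ∀ m → triangular m ≡ m C 2
triangular≡C2 zero    = refl
triangular≡C2 (suc m) = trans (cong (m +_) (triangular≡C2 m)) (sym ([1+n]C2 m))

rainbowColouring : ∀ m → Colouring (K m) (Fin (triangular m))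
rainbowColouring zero    = record { colour = λ () ; colour-sym = λ () }
rainbowColouring (suc m) = cone (_↑ˡ triangular m) (m ↑ʳ_) (rainbowColouring m)

↑ˡ≢↑ʳ : ∀ {m n} (i : Fin m) (j : Fin n) → i ↑ˡ n ≢ m ↑ʳ j
↑ˡ≢↑ʳ {m} {n} i j e with trans (sym (Finₚ.splitAt-↑ˡ m i n)) (trans (cong (splitAt m) e) (Finₚ.splitAt-↑ʳ m n j))
... | ()

rainbowColouring-star : ∀ m i → IsStar (colourClass (rainbowColouring m) i)
rainbowColouring-star (suc m) i = subst (IsStar ∘ colourClass (rainbowColouring (suc m))) (Finₚ.join-splitAt m _ i) (class (splitAt m i))
  where
  T = triangular m
  class : (x : Fin m ⊎ Fin T) → IsStar (colourClass (rainbowColouring (suc m)) ([ _↑ˡ T , m ↑ʳ_ ]′ x))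
  class (inj₂ j) = cone-star (Finₚ.↑ʳ-injective m _ _) (λ l → ↑ˡ≢↑ʳ l j) (rainbowColouring-star m j)
  class (inj₁ j) = record
    { m = 1 ; 1≤m = s≤s z≤n
    ; copy = record
      { map = edge
      ; injective = λ { {zero} {zero} _ → refl ; {suc zero} {suc zero} _ → refl ; {zero} {suc zero} () ; {suc zero} {zero} () }
      ; preserves = λ { (outward {zero}) → (λ ()) , refl ; (inward {zero}) → (λ ()) , refl } }
    ; covers = λ { {zero}  {zero}  (p , _) → contradiction refl p
                 ; {zero}  {suc y} (_ , e) → zero , suc zero , outward , refl , cong suc (sym (Finₚ.↑ˡ-injective T _ _ e))
                 ; {suc x} {zero}  (_ , e) → suc zero , zero , inward , cong suc (sym (Finₚ.↑ˡ-injective T _ _ e)) , refl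
                 ; {suc x} {suc y} (_ , e) → contradiction (sym e) (↑ˡ≢↑ʳ j _) }
    }
    where
    edge : Fin 2 → Fin (suc m)
    edge zero    = zero
    edge (suc _) = suc j

peel : ∀ {n s} → Colouring (K n) (Fin s) → Colouring (K (suc n)) (Fin (suc s))
peel = cone (const zero) suc

peel-star : ∀ {n s} {c : Colouring (K n) (Fin s)} → 1 ≤ n → (∀ i → IsStar (colourClass c i)) →
            ∀ i → IsStar (colourClass (peel c) i)
peel-star {n} 1≤n S zero = record
  { m = n ; 1≤m = 1≤n
  ; copy = record { map = id ; injective = id ; preserves = λ { outward → (λ ()) , refl ; inward → (λ ()) , refl } }
  ; covers = λ { {zero}  {zero}  (p , _) → contradiction refl p
               ; {zero}  {suc y} _       → _ , _ , outward , refl , refl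
               ; {suc x} {zero}  _       → _ , _ , inward , refl , refl
               ; {suc x} {suc y} (_ , ()) }
  }
peel-star {c = c} 1≤n S (suc i) = cone-star {α = const zero} {c = c} Finₚ.suc-injective (λ _ ()) (S i)

-- The extremal structure with a transitive tournament on the `a` added vertices.
peels : ∀ a m → Colouring (K (a + m)) (Fin (a + triangular m))
peels zero    m = rainbowColouring m
peels (suc a) m = peel (peels a m)

peels-star : ∀ a {m} → 1 ≤ m → ∀ i → IsStar (colourClass (peels a m) i)
peels-star zero    {m} _   = rainbowColouring-star m
peels-star (suc a) {m} 1≤m = peel-star (≤-trans 1≤m (m≤n+m m a)) (peels-star a 1≤m)

star⇒used : ∀ {n s} {c : Colouring (K n) (Fin s)} {i} → IsStar (colourClass c i) → IsUsed c i
star⇒used record { m = suc _ ; copy = copy } = _ , _ , Copy.preserves copy (outward {i = zero})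

successor : ∀ {k} (i : Fin (suc k)) → ∃[ j ] i ↝ j
successor {k} i with suc (toℕ i) ≤? k
... | yes p = fromℕ< (s≤s p) , step (Finₚ.toℕ-fromℕ< (s≤s p))
... | no ¬p = zero , wrap (≤-antisym (Finₚ.toℕ<n i) (≰⇒> ¬p)) refl

predecessor : ∀ {k} (i : Fin (suc k)) → ∃[ j ] j ↝ i
predecessor {k} zero    = fromℕ k , wrap (cong suc (Finₚ.toℕ-fromℕ k)) refl
predecessor     (suc i) = inject₁ i , step (cong suc (sym (Finₚ.toℕ-inject₁ i)))

peel-colour-zero : ∀ {n s} (c : Colouring (K n) (Fin s)) {x y} .(p : x ≢ y) → x ≡ zero → colour (peel c) x y p ≡ zero
peel-colour-zero c {y = zero}  p refl = ⊥-elim-irr (p refl)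
peel-colour-zero c {y = suc y} p refl = refl

peel-colour-suc : ∀ {n s} (c : Colouring (K n) (Fin s)) {x y x′ y′} .(p : x ≢ y) .(p′ : x′ ≢ y′) →
                  suc x′ ≡ x → suc y′ ≡ y → colour (peel c) x y p ≡ suc (colour c x′ y′ p′)
peel-colour-suc c p p′ refl refl = refl

-- Both edges of the cycle at a peeled vertex would have that vertex's colour.
peel-noRainbow : ∀ {n s k} {c : Colouring (K n) (Fin s)} (3≤k : 3 ≤ k) →
                 ¬ RainbowCopy (Cycle k 3≤k) c → ¬ RainbowCopy (Cycle k 3≤k) (peel c)
peel-noRainbow {k = suc k} {c} 3≤k none ρ with Finₚ.any? (λ i → Copy.map (RainbowCopy.copy ρ) i Finₚ.≟ zero)
... | yes (i , hi≡0) = let j , a = successor i ; l , b = predecessor i in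
  clash a b (rainbow (inj₁ a) (inj₂ b)
    (trans (peel-colour-zero c (preserves (inj₁ a)) hi≡0) (sym (peel-colour-zero c (preserves (inj₂ b)) hi≡0))))
  where
  open RainbowCopy ρ
  open Copy copy hiding (map)
  clash : ∀ {j l} → i ↝ j → l ↝ i → ¬ SameEdge i j i l
  clash a b (inj₁ (_ , refl)) = ↝-asym 3≤k a b
  clash a b (inj₂ (refl , _)) = ↝-asym 3≤k b b
... | no away = none record
  { copy = record
    { map = h ; injective = λ {i} {j} e → injective (trans (sym (suc-h i)) (trans (cong suc e) (suc-h j)))
    ; preserves = h-preserves }
  ; rainbow = λ e e′ eq → rainbow e e′
      (trans (peel-colour-suc c (preserves e) (h-preserves e) (suc-h _) (suc-h _)) (trans (cong suc eq)
        (sym (peel-colour-suc c (preserves e′) (h-preserves e′) (suc-h _) (suc-h _)))))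
  }
  where
  open RainbowCopy ρ
  open Copy copy renaming (map to g)
  h : Fin (suc k) → Fin _
  h i = punchOut {i = zero} {j = g i} (λ e → away (i , sym e))
  suc-h : ∀ i → suc (h i) ≡ g i
  suc-h i = Finₚ.punchIn-punchOut {i = zero} {j = g i} _
  h-preserves : ∀ {i j} → Adj (Cycle (suc k) 3≤k) i j → h i ≢ h j
  h-preserves {i} {j} a e = preserves a (trans (sym (suc-h i)) (trans (cong suc e) (suc-h j)))

peels-noRainbow : ∀ a {m k} (3≤k : 3 ≤ k) → m < k → ¬ RainbowCopy (Cycle k 3≤k) (peels a m)
peels-noRainbow zero    3≤k m<k ρ = Finₚ.<⇒notInjective m<k (Copy.injective (RainbowCopy.copy ρ))
peels-noRainbow (suc a) 3≤k m<k   = peel-noRainbow 3≤k (peels-noRainbow a 3≤k m<k)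

attains : ∀ a m {k} (3≤k : 3 ≤ k) → 1 ≤ m → m < k → Attains (a + m) (Cycle k 3≤k) (a + m C 2)
attains a m 3≤k 1≤m m<k = subst (λ T → Attains (a + m) (Cycle _ 3≤k) (a + T)) (triangular≡C2 m)
  (peels a m , ((λ i _ → peels-star a 1≤m i) , λ i → star⇒used (peels-star a 1≤m i)) , peels-noRainbow a 3≤k m<k)

-- Arithmetic of the colour count.

colours-formula : ∀ {n k} → 3 ≤ k → k ≤ n → n + (k ∸ 2) C 2 ∸ 1 ≡ (n ∸ k + 1) + (k ∸ 1) C 2
colours-formula {suc n} {suc (suc (suc j))} (s≤s (s≤s (s≤s _))) (s≤s k≤n) = begin
  n + suc j C 2                               ≡⟨ cong (_+ suc j C 2) (m∸n+n≡m k≤n) ⟨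
  (n ∸ (2 + j)) + (2 + j) + suc j C 2         ≡⟨ cong (_+ suc j C 2) (+-assoc (n ∸ (2 + j)) 1 (suc j)) ⟨
  (n ∸ (2 + j) + 1) + suc j + suc j C 2       ≡⟨ +-assoc (n ∸ (2 + j) + 1) (suc j) _ ⟩
  (n ∸ (2 + j) + 1) + (suc j + suc j C 2)     ≡⟨ cong (n ∸ (2 + j) + 1 +_) ([1+n]C2 (suc j)) ⟨
  (n ∸ (2 + j) + 1) + suc (suc j) C 2         ∎
  where open ≡-Reasoning

-- Returning a peeled vertex to the core trades one colour for as many pairs as the core has
-- vertices, which is at least one.
gap : ∀ q {r} → 1 ≤ r → q + r C 2 ≤ (q + r) C 2
gap zero        _   = ≤-refl
gap (suc q) {r} 1≤r = begin
  suc q + r C 2               ≤⟨ +-mono-≤ (≤-trans 1≤r (m≤n+m r q)) (gap q 1≤r) ⟩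
  (q + r) + (q + r) C 2       ≡⟨ [1+n]C2 (q + r) ⟨
  (suc q + r) C 2             ∎
  where open ≤-Reasoning

-- The last vertex returned joins a core of at least two vertices, so that exchange gains strictly.
gap-strict : ∀ q {r} → 1 ≤ r → 3 ≤ suc q + r → suc q + r C 2 < (suc q + r) C 2
gap-strict q {r} 1≤r (s≤s 2≤) = begin
  2 + (q + r C 2)             ≤⟨ +-mono-≤ 2≤ (gap q 1≤r) ⟩
  (q + r) + (q + r) C 2       ≡⟨ [1+n]C2 (q + r) ⟨
  (suc q + r) C 2             ∎
  where open ≤-Reasoning

module _ {n k} p {r} (3≤k : 3 ≤ k) (k≤n : k ≤ n) (p+r≡n : p + r ≡ n) (1≤r : 1 ≤ r) (r≤ : r ≤ k ∸ 1) where

  private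
    q = k ∸ 1 ∸ r

    q+r≡ : q + r ≡ k ∸ 1
    q+r≡ = m∸n+n≡m r≤

    p≡ : p ≡ (n ∸ k + 1) + q
    p≡ = +-cancelʳ-≡ r p _ (begin
      p + r                        ≡⟨ p+r≡n ⟩
      n                            ≡⟨ m∸n+n≡m (≤-trans (m∸n≤m k 1) k≤n) ⟨
      n ∸ (k ∸ 1) + (k ∸ 1)        ≡⟨ cong₂ _+_ (pred-complement 3≤k k≤n) (sym q+r≡) ⟩
      (n ∸ k + 1) + (q + r)        ≡⟨ +-assoc (n ∸ k + 1) q r ⟨
      (n ∸ k + 1) + q + r          ∎)
      where open ≡-Reasoning

    slots≡ : p + r C 2 ≡ (n ∸ k + 1) + (q + r C 2)
    slots≡ = trans (cong (_+ r C 2) p≡) (+-assoc (n ∸ k + 1) q (r C 2))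

  slots≤ : p + r C 2 ≤ (n ∸ k + 1) + (k ∸ 1) C 2
  slots≤ = subst₂ (λ x y → x ≤ (n ∸ k + 1) + y C 2) (sym slots≡) q+r≡ (+-monoʳ-≤ (n ∸ k + 1) (gap q 1≤r))

  extremal-size : r ≡ k ∸ 1 ⊎ 4 ≤ k → (n ∸ k + 1) + (k ∸ 1) C 2 ≤ p + r C 2 → r ≡ k ∸ 1
  extremal-size (inj₁ e) _ = e
  extremal-size (inj₂ 4≤k) full = by q q+r≡ (+-cancelˡ-≤ (n ∸ k + 1) _ _ (≤-trans full (≤-reflexive slots≡)))
    where
    by : ∀ q → q + r ≡ k ∸ 1 → (k ∸ 1) C 2 ≤ q + r C 2 → r ≡ k ∸ 1
    by zero    e _ = e
    by (suc q) e full = contradiction (subst (λ z → z C 2 ≤ suc q + r C 2) (sym e) full)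
      (<⇒≱ (gap-strict q 1≤r (subst (3 ≤_) (sym e) (∸-monoˡ-≤ 1 4≤k))))

-- Both bounds and the structure, assembled.

theorem1p4 : ∀ (n k : ℕ) (3≤k : 3 ≤ k) → k ≤ n →
    let s = n + ((k ∸ 2) C 2) ∸ 1 in
    (ar⋆⟨ n , Cycle k 3≤k ⟩≡ s)
    × (s ≡ (n ∸ k + 1) + ((k ∸ 1) C 2))
    × (∀ (c : Colouring (K n) (Fin s)) → (s -StarColouring) c → ¬ RainbowCopy (Cycle k 3≤k) c →
    Σ[ ρ ∈ Fin s ↣ Palette n ] Extremal k 3≤k (rename (Injection.to ρ) c))
theorem1p4 n k 3≤k k≤n = (lower , upper) , formula , structure
  where
  s = n + (k ∸ 2) C 2 ∸ 1

  formula : s ≡ (n ∸ k + 1) + (k ∸ 1) C 2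
  formula = colours-formula 3≤k k≤n

  1≤k : 1 ≤ k
  1≤k = ≤-trans (s≤s z≤n) 3≤k

  lower : Attains n (Cycle k 3≤k) s
  lower = subst₂ (λ n → Attains n (Cycle k 3≤k))
    (trans (cong (_+ (k ∸ 1)) (sym (pred-complement 3≤k k≤n))) (m∸n+n≡m (≤-trans (m∸n≤m k 1) k≤n)))
    (sym formula)
    -- The rainbow part has `k ∸ 1` vertices, too few for a cycle on `k` vertices.
    (attains (n ∸ k + 1) (k ∸ 1) 3≤k (∸-monoˡ-≤ 1 (<⇒≤ 3≤k)) (≤-reflexive (m+[n∸m]≡n 1≤k)))

  module Decomposition {t} (c : Colouring (K n) (Fin t)) (sc : (t -StarColouring) c)
    (none : ¬ RainbowCopy (Cycle k 3≤k) c) where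
    open Edges c (proj₁ sc)

    SmallCore : Set
    SmallCore = Σ[ d ∈ Core (allFin n) ] (let r = length (Core.R′ d) in 1 ≤ r × r ≤ k ∸ 1 × (r ≡ k ∸ 1 ⊎ 4 ≤ k))

    smallCore : SmallCore
    smallCore = core 3≤k k≤n (acyclic 3≤k none (allFin n))

    bounded : SmallCore → t ≤ (n ∸ k + 1) + (k ∸ 1) C 2
    bounded (d , 1≤r , r≤ , _) = ≤-trans colours≤ (slots≤ (length peeled) 3≤k k≤n length-peeled 1≤r r≤)
      where open Decomposed c (proj₁ sc) (proj₂ sc) d

    structured : (n ∸ k + 1) + (k ∸ 1) C 2 ≤ t → SmallCore →
                 Σ[ ρ ∈ Fin t ↣ Palette n ] Extremal k 3≤k (rename (Injection.to ρ) c)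
    structured full (d , 1≤r , r≤ , r≡⊎4≤k) = mk↣ ρ-injective , extremal 3≤k k≤n none
      (extremal-size (length peeled) 3≤k k≤n length-peeled 1≤r r≤ r≡⊎4≤k (≤-trans full colours≤))
      where
      open Decomposed c (proj₁ sc) (proj₂ sc) d
      open Tight (≤-trans (slots≤ (length peeled) 3≤k k≤n length-peeled 1≤r r≤) full)

  upper : ∀ t → Attains n (Cycle k 3≤k) t → t ≤ s
  upper t (c , sc , none) = subst (t ≤_) (sym formula) (bounded smallCore)
    where open Decomposition c sc none

  structure : ∀ (c : Colouring (K n) (Fin s)) → (s -StarColouring) c → ¬ RainbowCopy (Cycle k 3≤k) c →
              Σ[ ρ ∈ Fin s ↣ Palette n ] Extremal k 3≤k (rename (Injection.to ρ) c)
  structure c sc none = structured (≤-reflexive (sym formula)) smallCore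
    where open Decomposition c sc none
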